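{- Let $n$ and $t$ be positive integers with $t<n$, let $q$ be a prime power, and let $r = n \bmod t$. If $t > \frac{q^r-1}{q-1}$, then \[\mu_q(n,t) = \frac{q^n - q^{t+r}}{q^t-1} + 1.\]
   Context: ${\rm PG}(n-1,q)$ denotes the $(n-1)$-dimensional projective space over the finite field $\mathbb{F}_q$. A partial $(t-1)$-spread of ${\rm PG}(n-1,q)$ is a set of $(t-1)$-dimensional (projective) subspaces of ${\rm PG}(n-1,q)$ that are pairwise disjoint (equivalently, a set of $t$-dimensional subspaces of the vector space $\mathbb{F}_q^n$ pairwise intersecting only in the zero vector). $\mu_q(n,t)$ denotes the maximum size (cardinality) of a partial $(t-1)$-spread of ${\rm PG}(n-1,q)$. -}

module Defs where

open import Level using (0ℓ) renaming (suc to lsuc)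
open import Algebra.Bundles using (CommutativeRing)
open import Data.Nat using (ℕ; zero; suc; _≤_)
open import Data.Fin using (Fin; zero; suc)
open import Data.Product using (Σ; ∃; _×_; _,_)
open import Relation.Nullary using (¬_)
open import Relation.Binary.PropositionalEquality using (_≡_; _≢_)

-- A finite field with exactly q elements: a commutative ring (with setoid
-- equality _≈_) in which 0 ≉ 1 and every nonzero element is invertible,
-- together with a bijection (up to ≈) between Fin q and the carrier.
-- Since finite fields of order q exist exactly when q is a prime power and
-- are all isomorphic, quantifying over all such F models "F_q, q a prime power".
record FiniteField (q : ℕ) : Set₁ where
  field
    commRing : CommutativeRing 0ℓ 0ℓ
  open CommutativeRing commRing public
  field
    0≉1       : ¬ (0# ≈ 1#)
    inverse   : ∀ x → ¬ (x ≈ 0#) → ∃ λ y → x * y ≈ 1#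
    enum      : Fin q → Carrier
    enum-surj : ∀ x → ∃ λ i → enum i ≈ x
    enum-inj  : ∀ i j → enum i ≈ enum j → i ≡ j

module _ {q : ℕ} (F : FiniteField q) where
  open FiniteField F using (Carrier; _≈_; _+_; _*_; 0#)

  Vector : ℕ → Set
  Vector n = Fin n → Carrier

  ∑ : (k : ℕ) → (Fin k → Carrier) → Carrier
  ∑ zero    f = 0#
  ∑ (suc k) f = f zero + ∑ k (λ i → f (suc i))

  lincomb : {n t : ℕ} → (Fin t → Carrier) → (Fin t → Vector n) → Vector n
  lincomb {n} {t} c v k = ∑ t (λ i → c i * v i k)

  IsZeroVec : {n : ℕ} → Vector n → Set
  IsZeroVec v = ∀ k → v k ≈ 0#

  LinIndep : {n t : ℕ} → (Fin t → Vector n) → Set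
  LinIndep {n} {t} v = ∀ (c : Fin t → Carrier) → IsZeroVec (lincomb c v) → ∀ i → c i ≈ 0#

  -- a t-dimensional subspace of F^n, given by a basis (it is the span)
  Subspace : ℕ → ℕ → Set
  Subspace n t = Σ (Fin t → Vector n) LinIndep

  TrivialIntersection : {n t : ℕ} → Subspace n t → Subspace n t → Set
  TrivialIntersection {n} {t} (U , _) (W , _) =
    ∀ (a b : Fin t → Carrier) → (∀ k → lincomb a U k ≈ lincomb b W k) →
    IsZeroVec (lincomb a U)

  -- a partial (t-1)-spread of PG(n-1,q) of size m: m t-dim subspaces of F^n,
  -- pairwise intersecting trivially
  PartialSpread : (n t m : ℕ) → Set
  PartialSpread n t m =
    Σ (Fin m → Subspace n t) λ S → ∀ i j → i ≢ j → TrivialIntersection (S i) (S j)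

  IsMaxPartialSpreadSize : (n t m : ℕ) → Set
  IsMaxPartialSpreadSize n t m =
    PartialSpread n t m × (∀ k → PartialSpread n t k → k ≤ m)

{-# OPTIONS --safe #-}

-- Lower bound.  F has an irreducible polynomial f of every degree N ≥ 1: otherwise all
-- irreducible factors of X^(q^N) − X, which is squarefree, would divide the product of the
-- X^(q^d) − X with 1 ≤ d < N, whose degree is less than q^N.  For t ≤ N the q^N graphs
-- {(c , a c mod f)} ⊆ F^t × F^N, where c runs over the polynomials of degree < t and a over
-- those of degree < N, meet pairwise in 0, and they meet 0 × F^N in 0.  So a partial spread
-- of size s in F^N extends to one of size q^N + s in F^(t+N).  Start with one subspace of
-- F^(t+r).
--
-- Upper bound.  Let L (q^t − 1) = q^n − q^(t+r) and suppose there are L + 2 subspaces.  A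
-- hole is a vector in none of them.  If S is the set of common zeros of j functionals, S and
-- its intersections with the members have cardinalities q^e with e ≥ t − j.  Counting S
-- shows that its number of holes w satisfies w ≡ 1 mod q^(t−j) and w ≡ 0 mod q − 1, hence
-- w = (c (q − 1) − 1) q^(t−j) + 1 with c ≥ 0.  For j = 0, c = (q^r − 1) / (q − 1).
-- Averaging over all functionals yields one for which the number of holes drops to at most
-- w / q, and then c drops by at least 1.  As c < t initially, c would become negative.

module Submission where

open import Defs
open import Level using (Level; _⊔_)
open import Algebra.Bundles using (CommutativeMonoid; CommutativeRing)
open import Algebra.Morphism.Structures using (IsRingHomomorphism)
import Algebra.Properties.AbelianGroup
import Algebra.Properties.CommutativeMonoid.Sum
import Algebra.Properties.CommutativeSemiring.Exp
import Algebra.Properties.Group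
import Algebra.Properties.Ring
import Algebra.Properties.Semiring.Exp
import Algebra.Properties.Semiring.Mult.TCOptimised
import Algebra.Properties.Semiring.Sum
import Algebra.Solver.Ring
import Algebra.Solver.Ring.AlmostCommutativeRing as ACR
open import Data.Fin.Base as Fin
  using (Fin; zero; suc; toℕ; fromℕ<; inject≤; finToFun; funToFin; splitAt; join; _↑ˡ_; _↑ʳ_)
open import Data.Fin.Permutation using (Permutation; permutation; _⟨$⟩ʳ_)
import Data.Fin.Properties as Fin
open import Data.Integer.Base as ℤ using (ℤ)
import Data.Integer.Properties as ℤ
open import Data.List.Base using (List; []; _∷_; map)
open import Data.Maybe.Base as Maybe using (Maybe)
open import Data.Nat.Base as ℕ using (ℕ; zero; suc; _≤_; _<_; z≤n; s≤s; NonZero)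
import Data.Nat.Divisibility as ℕ∣
open import Data.Nat.DivMod using (_/_; _%_; m≡m%n+[m/n]*n; m*n/n≡m; m%n<n; /-congˡ)
open import Data.Nat.Induction using (<-rec)
import Data.Nat.Properties as ℕ
open import Data.Nat.Solver using (module +-*-Solver)
open import Data.Product.Base using (∃; ∃₂; _×_; _,_; proj₁; proj₂)
import Data.Sign.Base as Sign
open import Data.Sum.Base using (_⊎_; inj₁; inj₂)
open import Data.Unit.Base using (⊤; tt)
open import Data.Vec.Functional using (_++_)
import Data.Vec.Functional.Properties as Vector
open import Function.Base using (id)
open import Relation.Binary.Consequences using (dec⇒weaklyDec)
open import Relation.Binary.Definitions using (tri<; tri≈; tri>)
open import Relation.Binary.PropositionalEquality as ≡ using (_≡_; _≢_)
import Relation.Binary.Reasoning.Setoid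
open import Relation.Nullary using (¬_; ¬?; Dec; yes; no; contradiction; _×-dec_)
import Relation.Nullary.Decidable as Dec

-- Two graphs meet only in 0 when the difference of their matrices is injective on rows.
-- Multiplication in a field with `q ^ N` elements supplies `q ^ N` matrices with this property for
-- every pair, hence the need for irreducible polynomials of all degrees. The field `F` is given
-- only by its `q` elements, with no characteristic, so additivity of the `q`-th power is obtained
-- from root counting rather than from binomial coefficients. In the upper bound, counting in the
-- whole space alone gives no contradiction: it only confines the number of holes to an arithmetic
-- progression. Both residues come from the zero vector, which lies in every member. Modulo a power
-- of `q` dividing `L` and all cardinalities, its `L + 2` occurrences leave the residue 1; modulo
-- `q - 1` every power of `q` is 1 and everything cancels. The residue 1 is what drives the descent:
-- dividing the number of holes by `q` divides the main term exactly, but the 1 cannot be divided,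
-- so the coefficient has to give way. Each hyperplane costs one factor `q` of the modulus, so only
-- `t` steps are available.

module IntegerCoefficientSolver {c ℓ : Level} (R : CommutativeRing c ℓ) where
  open CommutativeRing R
  open import Data.Integer.Base using (+_; -[1+_])
  open Algebra.Properties.Semiring.Mult.TCOptimised semiring renaming (_×_ to _·_)
  open Algebra.Properties.Ring ring
  open Algebra.Properties.AbelianGroup +-abelianGroup
  open Relation.Binary.Reasoning.Setoid setoid

  -- With the optimised multiples, `1 · 1#` reduces to `1#`. A literal `con ℤ.1ℤ` therefore denotes
  -- `1#` definitionally, and solved equations match goals that mention `1#`.
  fromℤ : ℤ → Carrier
  fromℤ (+ n)    = n · 1#
  fromℤ -[1+ n ] = - (suc n · 1#)

  private
    suc-suc : ∀ x y → (1# + x) - (1# + y) ≈ x - y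
    suc-suc x y = begin
      (1# + x) - (1# + y)     ≈⟨ +-cong (+-comm 1# x) (-‿cong (+-comm 1# y)) ⟩
      (x + 1#) - (y + 1#)     ≈⟨ +-congˡ (⁻¹-anti-homo-∙ y 1#) ⟩
      (x + 1#) + (- 1# - y)   ≈⟨ +-assoc x 1# _ ⟩
      x + (1# + (- 1# - y))   ≈⟨ +-congˡ (+-assoc 1# (- 1#) (- y)) ⟨
      x + ((1# - 1#) - y)     ≈⟨ +-congˡ (+-congʳ (-‿inverseʳ 1#)) ⟩
      x + (0# - y)            ≈⟨ +-congˡ (+-identityˡ (- y)) ⟩
      x - y                   ∎

  fromℤ-⊖ : ∀ m n → fromℤ (m ℤ.⊖ n) ≈ m · 1# - n · 1#
  fromℤ-⊖ m       zero    = begin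
    m · 1#       ≈⟨ +-identityʳ _ ⟨
    m · 1# + 0#  ≈⟨ +-congˡ ε⁻¹≈ε ⟨
    m · 1# - 0#  ∎
  fromℤ-⊖ zero    (suc n) = sym (+-identityˡ _)
  fromℤ-⊖ (suc m) (suc n) = begin
    fromℤ (suc m ℤ.⊖ suc n)           ≡⟨ ≡.cong fromℤ (ℤ.[1+m]⊖[1+n]≡m⊖n m n) ⟩
    fromℤ (m ℤ.⊖ n)                   ≈⟨ fromℤ-⊖ m n ⟩
    m · 1# - n · 1#                   ≈⟨ suc-suc _ _ ⟨
    (1# + m · 1#) - (1# + n · 1#)     ≈⟨ +-cong (1+× m 1#) (-‿cong (1+× n 1#)) ⟨
    suc m · 1# - suc n · 1#           ∎

  fromℤ-+ : ∀ i j → fromℤ (i ℤ.+ j) ≈ fromℤ i + fromℤ j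
  fromℤ-+ (+ m)    (+ n)    = ×-homo-+ 1# m n
  fromℤ-+ (+ m)    -[1+ n ] = fromℤ-⊖ m (suc n)
  fromℤ-+ -[1+ m ] (+ n)    = trans (fromℤ-⊖ n (suc m)) (+-comm _ _)
  fromℤ-+ -[1+ m ] -[1+ n ] = begin
    - (suc (suc (m ℕ.+ n)) · 1#)      ≡⟨ ≡.cong (λ k → - (k · 1#)) (≡.cong suc (ℕ.+-suc m n)) ⟨
    - ((suc m ℕ.+ suc n) · 1#)        ≈⟨ -‿cong (×-homo-+ 1# (suc m) (suc n)) ⟩
    - (suc m · 1# + suc n · 1#)       ≈⟨ ⁻¹-∙-comm _ _ ⟨
    - (suc m · 1#) - (suc n · 1#)     ∎

  private
    fromℤ-pos◃ : ∀ n → fromℤ (Sign.+ ℤ.◃ n) ≈ n · 1#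
    fromℤ-pos◃ n = reflexive (≡.cong fromℤ (ℤ.+◃n≡+n n))

    fromℤ-neg◃ : ∀ n → fromℤ (Sign.- ℤ.◃ n) ≈ - (n · 1#)
    fromℤ-neg◃ zero    = sym ε⁻¹≈ε
    fromℤ-neg◃ (suc n) = refl

  fromℤ-* : ∀ i j → fromℤ (i ℤ.* j) ≈ fromℤ i * fromℤ j
  fromℤ-* (+ m)    (+ n)    = trans (fromℤ-pos◃ (m ℕ.* n)) (×1-homo-* m n)
  fromℤ-* (+ m)    -[1+ n ] = begin
    fromℤ (Sign.- ℤ.◃ (m ℕ.* suc n))  ≈⟨ fromℤ-neg◃ (m ℕ.* suc n) ⟩
    - ((m ℕ.* suc n) · 1#)            ≈⟨ -‿cong (×1-homo-* m (suc n)) ⟩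
    - (m · 1# * suc n · 1#)           ≈⟨ -‿distribʳ-* _ _ ⟩
    m · 1# * - (suc n · 1#)           ∎
  fromℤ-* -[1+ m ] (+ n)    = begin
    fromℤ (Sign.- ℤ.◃ (suc m ℕ.* n))  ≈⟨ fromℤ-neg◃ (suc m ℕ.* n) ⟩
    - ((suc m ℕ.* n) · 1#)            ≈⟨ -‿cong (×1-homo-* (suc m) n) ⟩
    - (suc m · 1# * n · 1#)           ≈⟨ -‿distribˡ-* _ _ ⟩
    - (suc m · 1#) * n · 1#           ∎
  fromℤ-* -[1+ m ] -[1+ n ] = begin
    fromℤ (Sign.+ ℤ.◃ (suc m ℕ.* suc n))  ≈⟨ fromℤ-pos◃ (suc m ℕ.* suc n) ⟩
    (suc m ℕ.* suc n) · 1#            ≈⟨ ×1-homo-* (suc m) (suc n) ⟩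
    suc m · 1# * suc n · 1#           ≈⟨ ⁻¹-involutive _ ⟨
    - - (suc m · 1# * suc n · 1#)     ≈⟨ -‿cong (-‿distribˡ-* _ _) ⟩
    - (- (suc m · 1#) * suc n · 1#)   ≈⟨ -‿distribʳ-* _ _ ⟩
    - (suc m · 1#) * - (suc n · 1#)   ∎

  fromℤ-neg : ∀ i → fromℤ (ℤ.- i) ≈ - fromℤ i
  fromℤ-neg (+ zero)  = sym ε⁻¹≈ε
  fromℤ-neg (+ suc n) = refl
  fromℤ-neg -[1+ n ]  = sym (⁻¹-involutive _)

  private
    homomorphism : ℤ.+-*-rawRing ACR.-Raw-AlmostCommutative⟶ ACR.fromCommutativeRing R
    homomorphism = record
      { ⟦_⟧    = fromℤ
      ; +-homo = fromℤ-+
      ; *-homo = fromℤ-*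
      ; -‿homo = fromℤ-neg
      ; 0-homo = refl
      ; 1-homo = refl
      }

    fromℤ-≟ : ∀ i j → Maybe (fromℤ i ≈ fromℤ j)
    fromℤ-≟ i j = Maybe.map (λ i≡j → reflexive (≡.cong fromℤ i≡j)) (dec⇒weaklyDec ℤ._≟_ i j)

  open Algebra.Solver.Ring ℤ.+-*-rawRing (ACR.fromCommutativeRing R) homomorphism fromℤ-≟ public
    using (solve; _:+_; _:*_; _:-_; :-_; con; _:=_)

-- Polynomials, quotient rings and root counting

module Polynomials {c ℓ : Level} (R : CommutativeRing c ℓ) where
  open CommutativeRing R
  open IntegerCoefficientSolver R
  open Algebra.Properties.Ring ring using (-0#≈0#)

  Poly : Set c
  Poly = List Carrier

  infixl 9 _!_
  infix 4 _≋_
  infixl 6 _⊕_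
  infixl 7 _⊗_

  _!_ : Poly → ℕ → Carrier
  []      ! i     = 0#
  (a ∷ p) ! zero  = a
  (a ∷ p) ! suc i = p ! i

  -- Lists that differ in trailing zeros represent the same polynomial, so equality is
  -- coefficientwise and no degree is stored. The record wrapper allows `p` and `q` to be inferred
  -- from a proof.
  record _≋_ (p q : Poly) : Set ℓ where
    constructor mk≋
    field coeff : ∀ i → p ! i ≈ q ! i
  open _≋_ public

  _⊕_ : Poly → Poly → Poly
  []      ⊕ q       = q
  (a ∷ p) ⊕ []      = a ∷ p
  (a ∷ p) ⊕ (b ∷ q) = a + b ∷ p ⊕ q

  scale : Carrier → Poly → Poly
  scale a = map (a *_)

  ⊖_ : Poly → Poly
  ⊖_ = map (-_)

  _⊗_ : Poly → Poly → Poly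
  []      ⊗ q = []
  (a ∷ p) ⊗ q = scale a q ⊕ (0# ∷ p ⊗ q)

  ⊕-! : ∀ p q i → (p ⊕ q) ! i ≈ p ! i + q ! i
  ⊕-! []      q       i       = sym (+-identityˡ _)
  ⊕-! (a ∷ p) []      i       = sym (+-identityʳ _)
  ⊕-! (a ∷ p) (b ∷ q) zero    = refl
  ⊕-! (a ∷ p) (b ∷ q) (suc i) = ⊕-! p q i

  scale-! : ∀ a p i → scale a p ! i ≈ a * p ! i
  scale-! a []      i       = sym (zeroʳ a)
  scale-! a (b ∷ p) zero    = refl
  scale-! a (b ∷ p) (suc i) = scale-! a p i

  ⊖-! : ∀ p i → (⊖ p) ! i ≈ - (p ! i)
  ⊖-! []      i       = sym -0#≈0#
  ⊖-! (a ∷ p) zero    = refl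
  ⊖-! (a ∷ p) (suc i) = ⊖-! p i

  ⊗-!-zero : ∀ a p q → ((a ∷ p) ⊗ q) ! 0 ≈ a * q ! 0
  ⊗-!-zero a p q = trans (⊕-! (scale a q) _ 0) (trans (+-identityʳ _) (scale-! a q 0))

  ⊗-!-suc : ∀ a p q i → ((a ∷ p) ⊗ q) ! suc i ≈ a * q ! suc i + (p ⊗ q) ! i
  ⊗-!-suc a p q i = trans (⊕-! (scale a q) _ (suc i)) (+-congʳ (scale-! a q (suc i)))

  ⊗-zeroʳ : ∀ p i → (p ⊗ []) ! i ≈ 0#
  ⊗-zeroʳ []      i       = refl
  ⊗-zeroʳ (a ∷ p) zero    = refl
  ⊗-zeroʳ (a ∷ p) (suc i) = ⊗-zeroʳ p i

  ⊗-∷ʳ-zero : ∀ p b q → (p ⊗ (b ∷ q)) ! 0 ≈ p ! 0 * b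
  ⊗-∷ʳ-zero []      b q = sym (zeroˡ b)
  ⊗-∷ʳ-zero (a ∷ p) b q = ⊗-!-zero a p (b ∷ q)

  -- The product recurses on its left factor only. Together with `⊗-∷ʳ-zero` this is the mirrored
  -- recursion on the right factor, which is what the induction for commutativity consumes.
  ⊗-∷ʳ-suc : ∀ p b q i → (p ⊗ (b ∷ q)) ! suc i ≈ p ! suc i * b + (p ⊗ q) ! i
  ⊗-∷ʳ-suc []      b q i       = sym (trans (+-identityʳ _) (zeroˡ b))
  ⊗-∷ʳ-suc (a ∷ p) b q zero    = trans (⊗-!-suc a p (b ∷ q) 0)
    (trans (+-congˡ (⊗-∷ʳ-zero p b q)) (trans (+-comm _ _) (+-congˡ (sym (⊗-!-zero a p q)))))
  ⊗-∷ʳ-suc (a ∷ p) b q (suc i) = trans (⊗-!-suc a p (b ∷ q) (suc i))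
    (trans (+-congˡ (⊗-∷ʳ-suc p b q i))
    (trans (solve 3 (λ x y z → x :+ (y :+ z) := y :+ (x :+ z)) refl _ _ _)
           (+-congˡ (sym (⊗-!-suc a p q i)))))

  ⊗-comm-! : ∀ p q i → (p ⊗ q) ! i ≈ (q ⊗ p) ! i
  ⊗-comm-! []      q i       = sym (⊗-zeroʳ q i)
  ⊗-comm-! (a ∷ p) q zero    =
    trans (⊗-!-zero a p q) (trans (*-comm a _) (sym (⊗-∷ʳ-zero q a p)))
  ⊗-comm-! (a ∷ p) q (suc i) = trans (⊗-!-suc a p q i)
    (trans (+-cong (*-comm a _) (⊗-comm-! p q i)) (sym (⊗-∷ʳ-suc q a p i)))

  ⊗-congˡ-! : ∀ p {q q′} → q ≋ q′ → ∀ i → (p ⊗ q) ! i ≈ (p ⊗ q′) ! i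
  ⊗-congˡ-! []      q≋q′ i       = refl
  ⊗-congˡ-! (a ∷ p) {q} {q′} q≋q′ zero    =
    trans (⊗-!-zero a p q) (trans (*-congˡ (coeff q≋q′ 0)) (sym (⊗-!-zero a p q′)))
  ⊗-congˡ-! (a ∷ p) {q} {q′} q≋q′ (suc i) = trans (⊗-!-suc a p q i)
    (trans (+-cong (*-congˡ (coeff q≋q′ (suc i))) (⊗-congˡ-! p q≋q′ i)) (sym (⊗-!-suc a p q′ i)))

  ⊗-distribʳ-! : ∀ r p q i → ((p ⊕ q) ⊗ r) ! i ≈ (p ⊗ r) ! i + (q ⊗ r) ! i
  ⊗-distribʳ-! r []      q       i       = sym (+-identityˡ _)
  ⊗-distribʳ-! r (a ∷ p) []      i       = sym (+-identityʳ _)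
  ⊗-distribʳ-! r (a ∷ p) (b ∷ q) zero    = trans (⊗-!-zero (a + b) (p ⊕ q) r)
    (trans (distribʳ (r ! 0) a b) (sym (+-cong (⊗-!-zero a p r) (⊗-!-zero b q r))))
  ⊗-distribʳ-! r (a ∷ p) (b ∷ q) (suc i) = trans (⊗-!-suc (a + b) (p ⊕ q) r i)
    (trans (+-congˡ (⊗-distribʳ-! r p q i))
    (trans (solve 5 (λ a b r x y → (a :+ b) :* r :+ (x :+ y) := (a :* r :+ x) :+ (b :* r :+ y))
              refl a b (r ! suc i) ((p ⊗ r) ! i) ((q ⊗ r) ! i))
           (sym (+-cong (⊗-!-suc a p r i) (⊗-!-suc b q r i)))))

  scale-⊗-! : ∀ a p q i → (scale a p ⊗ q) ! i ≈ a * (p ⊗ q) ! i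
  scale-⊗-! a []      q i       = sym (zeroʳ a)
  scale-⊗-! a (b ∷ p) q zero    = trans (⊗-!-zero (a * b) (scale a p) q)
    (trans (*-assoc a b _) (*-congˡ (sym (⊗-!-zero b p q))))
  scale-⊗-! a (b ∷ p) q (suc i) = trans (⊗-!-suc (a * b) (scale a p) q i)
    (trans (+-congˡ (scale-⊗-! a p q i))
    (trans (solve 4 (λ a b x y → a :* b :* x :+ a :* y := a :* (b :* x :+ y)) refl a b _ _)
           (*-congˡ (sym (⊗-!-suc b p q i)))))

  shift-⊗-! : ∀ p q i → ((0# ∷ p) ⊗ q) ! i ≈ (0# ∷ p ⊗ q) ! i
  shift-⊗-! p q zero    = trans (⊗-!-zero 0# p q) (zeroˡ _)
  shift-⊗-! p q (suc i) = trans (⊗-!-suc 0# p q i) (trans (+-congʳ (zeroˡ _)) (+-identityˡ _))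

  ⊗-assoc-! : ∀ p q r i → ((p ⊗ q) ⊗ r) ! i ≈ (p ⊗ (q ⊗ r)) ! i
  ⊗-assoc-! []      q r i = refl
  ⊗-assoc-! (a ∷ p) q r i = trans (⊗-distribʳ-! r (scale a q) (0# ∷ p ⊗ q) i)
    (trans (+-cong (trans (scale-⊗-! a q r i) (sym (scale-! a (q ⊗ r) i)))
                   (trans (shift-⊗-! (p ⊗ q) r i) (lemma i)))
           (sym (⊕-! (scale a (q ⊗ r)) _ i)))
    where
    lemma : ∀ i → (0# ∷ (p ⊗ q) ⊗ r) ! i ≈ (0# ∷ p ⊗ (q ⊗ r)) ! i
    lemma zero    = refl
    lemma (suc i) = ⊗-assoc-! p q r i

  ⊗-identityˡ-! : ∀ p i → ((1# ∷ []) ⊗ p) ! i ≈ p ! i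
  ⊗-identityˡ-! p zero    = trans (⊗-!-zero 1# [] p) (*-identityˡ _)
  ⊗-identityˡ-! p (suc i) = trans (⊗-!-suc 1# [] p i) (trans (+-identityʳ _) (*-identityˡ _))

  polyRing : CommutativeRing c ℓ
  polyRing = record
    { Carrier = Poly ; _≈_ = _≋_ ; _+_ = _⊕_ ; _*_ = _⊗_ ; -_ = ⊖_ ; 0# = [] ; 1# = 1# ∷ []
    ; isCommutativeRing = record
      { isRing = record
        { +-isAbelianGroup = record
          { isGroup = record
            { isMonoid = record
              { isSemigroup = record
                { isMagma = record
                  { isEquivalence = record
                    { refl  = mk≋ λ i → refl
                    ; sym   = λ p≋q → mk≋ λ i → sym (coeff p≋q i)
                    ; trans = λ p≋q q≋r → mk≋ λ i → trans (coeff p≋q i) (coeff q≋r i)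
                    }
                  ; ∙-cong = λ {p} {p′} {q} {q′} p≋p′ q≋q′ → mk≋ λ i → trans (⊕-! p q i)
                      (trans (+-cong (coeff p≋p′ i) (coeff q≋q′ i)) (sym (⊕-! p′ q′ i)))
                  }
                ; assoc = λ p q r → mk≋ λ i →
                    trans (trans (⊕-! (p ⊕ q) r i) (+-congʳ (⊕-! p q i)))
                    (trans (+-assoc _ _ _)
                    (sym (trans (⊕-! p (q ⊕ r) i) (+-congˡ (⊕-! q r i)))))
                }
              ; identity = (λ p → mk≋ λ i → refl)
                         , (λ p → mk≋ λ i → trans (⊕-! p [] i) (+-identityʳ _))
              }
            ; inverse = (λ p → mk≋ λ i → trans (⊕-! (⊖ p) p i)
                            (trans (+-congʳ (⊖-! p i)) (-‿inverseˡ _)))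
                      , (λ p → mk≋ λ i → trans (⊕-! p (⊖ p) i)
                            (trans (+-congˡ (⊖-! p i)) (-‿inverseʳ _)))
            ; ⁻¹-cong = λ {p} {q} p≋q → mk≋ λ i →
                trans (⊖-! p i) (trans (-‿cong (coeff p≋q i)) (sym (⊖-! q i)))
            }
          ; comm = λ p q → mk≋ λ i →
              trans (⊕-! p q i) (trans (+-comm _ _) (sym (⊕-! q p i)))
          }
        ; *-cong = λ {p} {p′} {q} {q′} p≋p′ q≋q′ → mk≋ λ i → trans (⊗-congˡ-! p q≋q′ i)
            (trans (⊗-comm-! p q′ i) (trans (⊗-congˡ-! q′ p≋p′ i) (⊗-comm-! q′ p′ i)))
        ; *-assoc = λ p q r → mk≋ (⊗-assoc-! p q r)
        ; *-identity = (λ p → mk≋ (⊗-identityˡ-! p))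
                     , (λ p → mk≋ λ i → trans (⊗-comm-! p (1# ∷ []) i) (⊗-identityˡ-! p i))
        ; distrib = (λ p q r → mk≋ λ i → trans (⊗-comm-! p (q ⊕ r) i)
                        (trans (⊗-distribʳ-! p q r i)
                        (trans (+-cong (⊗-comm-! q p i) (⊗-comm-! r p i))
                               (sym (⊕-! (p ⊗ q) (p ⊗ r) i)))))
                  , (λ r p q → mk≋ λ i → trans (⊗-distribʳ-! r p q i)
                        (sym (⊕-! (p ⊗ r) (q ⊗ r) i)))
        }
      ; *-comm = λ p q → mk≋ (⊗-comm-! p q)
      }
    }

module PrincipalQuotient {c ℓ : Level} (R : CommutativeRing c ℓ) (f : CommutativeRing.Carrier R) where
  open CommutativeRing R hiding (zero)
  open IntegerCoefficientSolver R

  infix 4 _≈ᶠ_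
  -- Only the equality is coarsened; the carrier and the operations stay those of `R`, so ring laws
  -- pass to the quotient through `≈⇒≈ᶠ` and no representatives have to be chosen.
  record _≈ᶠ_ (x y : Carrier) : Set (c ⊔ ℓ) where
    constructor _,ᶠ_
    field
      multiplier : Carrier
      equality   : x ≈ y + f * multiplier

  ≈⇒≈ᶠ : ∀ {x y} → x ≈ y → x ≈ᶠ y
  ≈⇒≈ᶠ {x} {y} x≈y = 0# ,ᶠ trans x≈y (solve 2 (λ y f → y := y :+ f :* con ℤ.0ℤ) refl y f)

  quotientRing : CommutativeRing c (c ⊔ ℓ)
  quotientRing = record
    { Carrier = Carrier ; _≈_ = _≈ᶠ_ ; _+_ = _+_ ; _*_ = _*_ ; -_ = -_ ; 0# = 0# ; 1# = 1#
    ; isCommutativeRing = record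
      { isRing = record
        { +-isAbelianGroup = record
          { isGroup = record
            { isMonoid = record
              { isSemigroup = record
                { isMagma = record
                  { isEquivalence = record
                    { refl  = ≈⇒≈ᶠ refl
                    ; sym   = λ { {x} {y} (k ,ᶠ e) → (- k) ,ᶠ
                        trans (solve 3 (λ y f k → y := (y :+ f :* k) :+ f :* :- k) refl y f k)
                              (+-congʳ (sym e)) }
                    ; trans = λ { {x} {y} {z} (k ,ᶠ e) (l ,ᶠ e′) → (l + k) ,ᶠ
                        trans e (trans (+-congʳ e′)
                          (solve 4 (λ z f k l → (z :+ f :* l) :+ f :* k := z :+ f :* (l :+ k))
                            refl z f k l)) }
                    }
                  ; ∙-cong = λ { {x} {y} {u} {v} (k ,ᶠ e) (l ,ᶠ e′) → (k + l) ,ᶠ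
                      trans (+-cong e e′)
                        (solve 5 (λ y v f k l → (y :+ f :* k) :+ (v :+ f :* l)
                                             := (y :+ v) :+ f :* (k :+ l)) refl y v f k l) }
                  }
                ; assoc = λ x y z → ≈⇒≈ᶠ (+-assoc x y z)
                }
              ; identity = (λ x → ≈⇒≈ᶠ (+-identityˡ x)) , (λ x → ≈⇒≈ᶠ (+-identityʳ x))
              }
            ; inverse = (λ x → ≈⇒≈ᶠ (-‿inverseˡ x)) , (λ x → ≈⇒≈ᶠ (-‿inverseʳ x))
            ; ⁻¹-cong = λ { {x} {y} (k ,ᶠ e) → (- k) ,ᶠ trans (-‿cong e)
                (solve 3 (λ y f k → :- (y :+ f :* k) := :- y :+ f :* :- k) refl y f k) }
            }
          ; comm = λ x y → ≈⇒≈ᶠ (+-comm x y)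
          }
        ; *-cong = λ { {x} {y} {u} {v} (k ,ᶠ e) (l ,ᶠ e′) → (k * v + y * l + f * k * l) ,ᶠ
            trans (*-cong e e′)
              (solve 5 (λ y v f k l → (y :+ f :* k) :* (v :+ f :* l)
                 := y :* v :+ f :* (k :* v :+ y :* l :+ f :* k :* l)) refl y v f k l) }
        ; *-assoc = λ x y z → ≈⇒≈ᶠ (*-assoc x y z)
        ; *-identity = (λ x → ≈⇒≈ᶠ (*-identityˡ x)) , (λ x → ≈⇒≈ᶠ (*-identityʳ x))
        ; distrib = (λ x y z → ≈⇒≈ᶠ (distribˡ x y z)) , (λ x y z → ≈⇒≈ᶠ (distribʳ x y z))
        }
      ; *-comm = λ x y → ≈⇒≈ᶠ (*-comm x y)
      }
    }

module PolynomialFunctions {c ℓ : Level} (R : CommutativeRing c ℓ) where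
  open CommutativeRing R hiding (zero)
  open IntegerCoefficientSolver R
  open Algebra.Properties.Semiring.Exp semiring using (_^_)

  -- PolyFn d a f: f is a polynomial function of degree at most d whose
  -- coefficient of degree d is a, characterised by the factor theorem.
  PolyFn : ℕ → Carrier → (Carrier → Carrier) → Set (c ⊔ ℓ)
  PolyFn zero    a f = ∀ x → f x ≈ a
  PolyFn (suc d) a f = ∀ r → ∃ λ g → PolyFn d a g × (∀ x → f x ≈ f r + (x - r) * g x)

  PolyFn-resp : ∀ d {a b f} → a ≈ b → PolyFn d a f → PolyFn d b f
  PolyFn-resp zero    a≈b P x = trans (P x) a≈b
  PolyFn-resp (suc d) a≈b P r with P r
  ... | g , Pg , eq = g , PolyFn-resp d a≈b Pg , eq

  PolyFn-+ : ∀ d {a b f g} → PolyFn d a f → PolyFn d b g → PolyFn d (a + b) (λ x → f x + g x)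
  PolyFn-+ zero    P Q x = +-cong (P x) (Q x)
  PolyFn-+ (suc d) {f = f} {g} P Q r with P r | Q r
  ... | f′ , P′ , e | g′ , Q′ , e′ = (λ x → f′ x + g′ x) , PolyFn-+ d P′ Q′ , λ x →
    trans (+-cong (e x) (e′ x))
      (solve 5 (λ u v y w z → (u :+ y :* w) :+ (v :+ y :* z) := u :+ v :+ y :* (w :+ z))
        refl (f r) (g r) (x - r) (f′ x) (g′ x))

  PolyFn-* : ∀ d {a f} k → PolyFn d a f → PolyFn d (k * a) (λ x → k * f x)
  PolyFn-* zero    k P x = *-congˡ (P x)
  PolyFn-* (suc d) {f = f} k P r with P r
  ... | g , Pg , e = (λ x → k * g x) , PolyFn-* d k Pg , λ x →
    trans (*-congˡ (e x))
      (solve 4 (λ k u y v → k :* (u :+ y :* v) := k :* u :+ y :* (k :* v))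
        refl k (f r) (x - r) (g x))

  PolyFn-weaken : ∀ d {a f} → PolyFn d a f → PolyFn (suc d) 0# f
  PolyFn-weaken zero    {f = f} P r = (λ _ → 0#) , (λ _ → refl) , λ x →
    trans (P x) (trans (sym (P r)) (solve 2 (λ u y → u := u :+ y :* con ℤ.0ℤ) refl (f r) (x - r)))
  PolyFn-weaken (suc d) P r with P r
  ... | g , Pg , e = g , PolyFn-weaken d Pg , e

  PolyFn-weakenBy : ∀ k {d a f} → PolyFn d a f → PolyFn (suc (k ℕ.+ d)) 0# f
  PolyFn-weakenBy zero    {d} P = PolyFn-weaken d P
  PolyFn-weakenBy (suc k) {d} P = PolyFn-weaken (suc (k ℕ.+ d)) (PolyFn-weakenBy k P)

  -- If `f x = f r + (x - r) g x`, then `x f x = r f r + (x - r) (f x + r g x)`. The summand `r g x`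
  -- has lower degree than `f`, so it leaves the leading coefficient alone.
  PolyFn-x* : ∀ d {a f} → PolyFn d a f → PolyFn (suc d) a (λ x → x * f x)
  PolyFn-x* zero    {f = f} P r = f , P , λ x →
    trans (solve 3 (λ x r u → x :* u := r :* u :+ (x :- r) :* u) refl x r (f x))
          (+-congʳ (*-congˡ (trans (P x) (sym (P r)))))
  PolyFn-x* (suc d) {f = f} P r with P r
  ... | g , Pg , e = (λ x → f x + r * g x)
      , PolyFn-resp (suc d) (trans (+-congˡ (zeroʳ r)) (+-identityʳ _))
          (PolyFn-+ (suc d) P (PolyFn-* (suc d) r (PolyFn-weaken d Pg)))
      , λ x → trans (solve 3 (λ x r u → x :* u := (x :- r) :* u :+ r :* u) refl x r (f x))
          (trans (+-congˡ (*-congˡ (e x)))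
            (solve 5 (λ x r u v w → (x :- r) :* u :+ r :* (v :+ (x :- r) :* w)
                                 := r :* v :+ (x :- r) :* (u :+ r :* w))
              refl x r (f x) (f r) (g x)))

  PolyFn-const : ∀ d a → PolyFn (suc d) 0# (λ _ → a)
  PolyFn-const zero    a = PolyFn-weaken 0 {a} (λ _ → refl)
  PolyFn-const (suc d) a = PolyFn-weaken (suc d) (PolyFn-const d a)

  PolyFn-^ : ∀ d → PolyFn d 1# (_^ d)
  PolyFn-^ zero    x = refl
  PolyFn-^ (suc d)   = PolyFn-x* d (PolyFn-^ d)

  -- The exponent is written as at least two so that `- x` stays below the leading term.
  PolyFn-x^d-x : ∀ d → PolyFn (suc (suc d)) 1# (λ x → x ^ suc (suc d) - x)
  PolyFn-x^d-x d = PolyFn-resp (suc (suc d))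
      (solve 0 (con ℤ.1ℤ :+ con ℤ.0ℤ := con ℤ.1ℤ) refl)
      (PolyFn-+ (suc (suc d)) (PolyFn-^ (suc (suc d))) -x)
    where
    -x₁ : PolyFn 1 (- 1#) (λ x → - x)
    -x₁ r = (λ _ → - 1#) , (λ _ → refl) , λ x →
      solve 2 (λ x r → :- x := :- r :+ (x :- r) :* :- con ℤ.1ℤ) refl x r
    -x : PolyFn (suc (suc d)) 0# (λ x → - x)
    -x = ≡.subst (λ k → PolyFn (suc k) 0# (λ x → - x)) (ℕ.+-comm d 1) (PolyFn-weakenBy d -x₁)

  NoZeroDivisors : Set (c ⊔ ℓ)
  NoZeroDivisors = ∀ x y → ¬ (x ≈ 0#) → x * y ≈ 0# → y ≈ 0#

  -- Splitting off the first root leaves a function of degree one less that vanishes at the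
  -- remaining roots, because the nonzero factor `x - r` can be cancelled; a constant with a root is
  -- zero. This is the bound on the number of roots.
  leading≈0 : NoZeroDivisors → ∀ d {a f} → PolyFn d a f → (ρ : Fin (suc d) → Carrier) →
              (∀ i j → ρ i ≈ ρ j → i ≡ j) → (∀ i → f (ρ i) ≈ 0#) → a ≈ 0#
  leading≈0 nzd zero    P ρ inj roots = trans (sym (P (ρ zero))) (roots zero)
  leading≈0 nzd (suc d) P ρ inj roots with P (ρ zero)
  ... | g , Pg , e = leading≈0 nzd d Pg (λ i → ρ (suc i)) inj′ roots′
    where
    inj′ : ∀ i j → ρ (suc i) ≈ ρ (suc j) → i ≡ j
    inj′ i j eq with inj (suc i) (suc j) eq
    ... | ≡.refl = ≡.refl
    roots′ : ∀ i → g (ρ (suc i)) ≈ 0#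
    roots′ i = nzd (ρ (suc i) - ρ zero) (g (ρ (suc i)))
      (λ eq → contradiction
        (inj (suc i) zero (trans (solve 2 (λ x y → x := (x :- y) :+ y) refl _ _)
                          (trans (+-congʳ eq) (+-identityˡ _)))) λ ())
      (trans (trans (sym (+-identityˡ _)) (+-congʳ (sym (roots zero))))
             (trans (sym (e (ρ (suc i)))) (roots (suc i))))

module Evaluation {c ℓ c′ ℓ′ : Level} (R : CommutativeRing c ℓ) (S : CommutativeRing c′ ℓ′)
  (ι : CommutativeRing.Carrier R → CommutativeRing.Carrier S)
  (ι-homo : IsRingHomomorphism (CommutativeRing.rawRing R) (CommutativeRing.rawRing S) ι)
  where
  open IsRingHomomorphism ι-homo using () renaming
    (⟦⟧-cong to ι-cong; +-homo to ι-+; *-homo to ι-*; 0#-homo to ι-0; 1#-homo to ι-1)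
  module R = CommutativeRing R
  open CommutativeRing S
  open Polynomials R
  open IntegerCoefficientSolver S

  -- The coefficient map `ι` serves two purposes: with the identity this evaluates at field
  -- elements, with the constant embedding it composes polynomials.
  eval : Carrier → Poly → Carrier
  eval y []      = 0#
  eval y (a ∷ p) = ι a + y * eval y p

  eval-≋0 : ∀ y p → p ≋ [] → eval y p ≈ 0#
  eval-≋0 y []      e = refl
  eval-≋0 y (a ∷ p) e = trans
    (+-cong (trans (ι-cong (coeff e 0)) ι-0) (*-congˡ (eval-≋0 y p (mk≋ λ i → coeff e (suc i)))))
    (trans (+-identityˡ _) (zeroʳ y))

  eval-cong : ∀ y {p q} → p ≋ q → eval y p ≈ eval y q
  eval-cong y {[]}    {q}     e = sym (eval-≋0 y q (mk≋ λ i → R.sym (coeff e i)))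
  eval-cong y {a ∷ p} {[]}    e = eval-≋0 y (a ∷ p) e
  eval-cong y {a ∷ p} {b ∷ q} e = +-cong (ι-cong (coeff e 0))
    (*-congˡ (eval-cong y {p} {q} (mk≋ λ i → coeff e (suc i))))

  eval-⊕ : ∀ y p q → eval y (p ⊕ q) ≈ eval y p + eval y q
  eval-⊕ y []      q       = sym (+-identityˡ _)
  eval-⊕ y (a ∷ p) []      = sym (+-identityʳ _)
  eval-⊕ y (a ∷ p) (b ∷ q) = trans (+-cong (ι-+ a b) (*-congˡ (eval-⊕ y p q)))
    (solve 5 (λ a b y u v → (a :+ b) :+ y :* (u :+ v) := (a :+ y :* u) :+ (b :+ y :* v))
      refl (ι a) (ι b) y (eval y p) (eval y q))

  eval-scale : ∀ y a p → eval y (scale a p) ≈ ι a * eval y p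
  eval-scale y a []      = sym (zeroʳ _)
  eval-scale y a (b ∷ p) = trans (+-cong (ι-* a b) (*-congˡ (eval-scale y a p)))
    (solve 4 (λ a b y u → a :* b :+ y :* (a :* u) := a :* (b :+ y :* u))
      refl (ι a) (ι b) y (eval y p))

  eval-⊗ : ∀ y p q → eval y (p ⊗ q) ≈ eval y p * eval y q
  eval-⊗ y []      q = sym (zeroˡ _)
  eval-⊗ y (a ∷ p) q = trans (eval-⊕ y (scale a q) _)
    (trans (+-cong (eval-scale y a q) (+-cong ι-0 (*-congˡ (eval-⊗ y p q))))
    (solve 4 (λ a y u v → a :* v :+ (con ℤ.0ℤ :+ y :* (u :* v)) := (a :+ y :* u) :* v)
      refl (ι a) y (eval y p) (eval y q)))

  eval-1 : ∀ y → eval y (R.1# ∷ []) ≈ 1#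
  eval-1 y = trans (+-cong ι-1 (zeroʳ y)) (+-identityʳ 1#)

  open Algebra.Properties.Semiring.Exp semiring using (_^_)
  open Algebra.Properties.Semiring.Exp (CommutativeRing.semiring polyRing)
    using () renaming (_^_ to _⊗^_)

  eval-^ : ∀ y p n → eval y (p ⊗^ n) ≈ eval y p ^ n
  eval-^ y p zero    = eval-1 y
  eval-^ y p (suc n) = trans (eval-⊗ y p (p ⊗^ n)) (*-congˡ (eval-^ y p n))

-- Finite fields

module SingleTerm {c ℓ : Level} (M : CommutativeMonoid c ℓ) where
  open CommutativeMonoid M
  open Algebra.Properties.CommutativeMonoid.Sum M

  sum-single : ∀ {n} (f : Fin n → Carrier) i → (∀ j → j ≢ i → f j ≈ ε) → sum f ≈ f i
  sum-single {suc n} f i others = trans (sum-remove {i = i} f)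
    (trans (∙-congˡ (trans (sum-cong-≋ (λ j → others (Fin.punchIn i j) (Fin.punchInᵢ≢i i j)))
                           (sum-replicate-zero n)))
           (identityʳ (f i)))

module FiniteFields {q : ℕ} (F : FiniteField q) where
  open FiniteField F hiding (zero)
  open IntegerCoefficientSolver commRing
  open PolynomialFunctions commRing
  open Algebra.Properties.Semiring.Exp semiring using (_^_; ^-congˡ)
  open Algebra.Properties.CommutativeMonoid.Sum *-commutativeMonoid
    using (sum-cong-≋; sum-replicate; ∑-distrib-+; sum-permute) renaming (sum to ∏)
  open SingleTerm *-commutativeMonoid renaming (sum-single to ∏-single)

  index : Carrier → Fin q
  index x = proj₁ (enum-surj x)

  enum-index : ∀ x → enum (index x) ≈ x
  enum-index x = proj₂ (enum-surj x)

  index-cong : ∀ {x y} → x ≈ y → index x ≡ index y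
  index-cong {x} {y} x≈y =
    enum-inj _ _ (trans (enum-index x) (trans x≈y (sym (enum-index y))))

  index-enum : ∀ i → index (enum i) ≡ i
  index-enum i = enum-inj _ _ (enum-index (enum i))

  infix 4 _≈?_
  _≈?_ : ∀ x y → Dec (x ≈ y)
  x ≈? y = Dec.map′ (λ eq → trans (sym (enum-index x)) (trans (reflexive (≡.cong enum eq)) (enum-index y)))
    index-cong (index x Fin.≟ index y)

  -- Numbering vectors by the base-`q` digits of an index turns every later count over `F^n` into a
  -- finite sum over `Fin (q ℕ.^ n)`.
  vector : ∀ {n} → Fin (q ℕ.^ n) → Fin n → Carrier
  vector i k = enum (finToFun i k)

  vectorIndex : ∀ {n} → (Fin n → Carrier) → Fin (q ℕ.^ n)
  vectorIndex v = funToFin (λ k → index (v k))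

  vector-vectorIndex : ∀ {n} (v : Fin n → Carrier) k → vector (vectorIndex v) k ≈ v k
  vector-vectorIndex v k =
    trans (reflexive (≡.cong enum (Fin.finToFun-funToFin (λ k → index (v k)) k))) (enum-index (v k))

  funToFin-cong : ∀ {m n} {f g : Fin m → Fin n} → (∀ i → f i ≡ g i) → funToFin f ≡ funToFin g
  funToFin-cong {zero}  f≗g = ≡.refl
  funToFin-cong {suc m} f≗g = ≡.cong₂ Fin.combine (f≗g zero) (funToFin-cong (λ i → f≗g (suc i)))

  vector-injective : ∀ {n} (i j : Fin (q ℕ.^ n)) → (∀ k → vector i k ≈ vector j k) → i ≡ j
  vector-injective {n} i j eq = ≡.trans (≡.sym (Fin.funToFin-finToFin {n} i))
    (≡.trans (funToFin-cong {n} (λ k → enum-inj _ _ (eq k))) (Fin.funToFin-finToFin {n} j))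

  noZeroDivisors : NoZeroDivisors
  noZeroDivisors x y x≉0 xy≈0 with inverse x x≉0
  ... | z , xz≈1 = trans (sym (*-identityˡ y)) (trans (*-congʳ (sym xz≈1))
    (trans (solve 3 (λ x y z → x :* z :* y := z :* (x :* y)) refl x y z)
    (trans (*-congˡ xy≈0) (zeroʳ z))))

  1<q : 1 ℕ.< q
  1<q = Fin.injective⇒≤ {f = f} λ {i} {j} → f-injective i j
    where
    f : Fin 2 → Fin q
    f zero       = index 0#
    f (suc zero) = index 1#
    0≢1 : index 0# ≢ index 1#
    0≢1 eq = 0≉1 (trans (sym (enum-index 0#)) (trans (reflexive (≡.cong enum eq)) (enum-index 1#)))
    f-injective : ∀ i j → f i ≡ f j → i ≡ j
    f-injective zero       zero       eq = ≡.refl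
    f-injective zero       (suc zero) eq = contradiction eq 0≢1
    f-injective (suc zero) zero       eq = contradiction (≡.sym eq) 0≢1
    f-injective (suc zero) (suc zero) eq = ≡.refl

  private
    ifZero : Carrier → Carrier → Carrier → Carrier
    ifZero x a b with x ≈? 0#
    ... | yes _ = a
    ... | no  _ = b

    ifZero-zero : ∀ {x a b} → x ≈ 0# → ifZero x a b ≈ a
    ifZero-zero {x} x≈0 with x ≈? 0#
    ... | yes _   = refl
    ... | no  x≉0 = contradiction x≈0 x≉0

    ifZero-nonzero : ∀ {x a b} → ¬ (x ≈ 0#) → ifZero x a b ≈ b
    ifZero-nonzero {x} x≉0 with x ≈? 0#
    ... | yes x≈0 = contradiction x≈0 x≉0
    ... | no  _   = refl

    unit : Carrier → Carrier
    unit x = ifZero x 1# x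

    unit-cong : ∀ {x y} → x ≈ y → unit x ≈ unit y
    unit-cong {x} {y} x≈y with x ≈? 0#
    ... | yes x≈0 = sym (ifZero-zero (trans (sym x≈y) x≈0))
    ... | no  x≉0 = trans x≈y (sym (ifZero-nonzero (λ y≈0 → x≉0 (trans x≈y y≈0))))

    unit≉0 : ∀ x → ¬ (unit x ≈ 0#)
    unit≉0 x with x ≈? 0#
    ... | yes _   = λ 1≈0 → 0≉1 (sym 1≈0)
    ... | no  x≉0 = x≉0

    ∏≉0 : ∀ {n} (f : Fin n → Carrier) → (∀ i → ¬ (f i ≈ 0#)) → ¬ (∏ f ≈ 0#)
    ∏≉0 {zero}  f f≉0 eq = 0≉1 (sym eq)
    ∏≉0 {suc n} f f≉0 eq =
      ∏≉0 (λ i → f (suc i)) (λ i → f≉0 (suc i)) (noZeroDivisors (f zero) _ (f≉0 zero) eq)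

    times : ∀ a b → a * b ≈ 1# → Permutation q q
    times a b ab≈1 = permutation (λ i → index (a * enum i)) (λ i → index (b * enum i))
      (inv a b ab≈1) (inv b a (trans (*-comm b a) ab≈1))
      where
      inv : ∀ a b → a * b ≈ 1# → ∀ i → index (a * enum (index (b * enum i))) ≡ i
      inv a b ab≈1 i = ≡.trans (index-cong (trans (*-congˡ (enum-index _))
        (trans (sym (*-assoc a b _)) (trans (*-congʳ ab≈1) (*-identityˡ _))))) (index-enum i)

  -- Multiplication by x permutes the nonzero elements; unit replaces the
  -- factor 0 by 1 in their product.
  fermat : ∀ x → x ^ q ≈ x
  fermat x with x ≈? 0#
  ... | yes x≈0 = trans (^-congˡ q x≈0) (trans (zero^q 1<q) (sym x≈0))
    where
    zero^q : ∀ {n} → 1 ℕ.< n → 0# ^ n ≈ 0#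
    zero^q {suc n} _ = zeroˡ _
  ... | no  x≉0 with inverse x x≉0
  ... | y , xy≈1 = cancel
    where
    -- At every index `h` and `k` multiply to `x`, so `x ^ q` is `∏h * ∏k`. Only the index of zero
    -- contributes to `∏k`, giving `x`, while `h` collects exactly the factors by which
    -- multiplication by `x` changes `unit`, so that `∏h` cancels to 1.
    h k : Fin q → Carrier
    h i = ifZero (enum i) 1# x
    k i = ifZero (enum i) x 1#

    h*k≈x : ∀ i → h i * k i ≈ x
    h*k≈x i with enum i ≈? 0#
    ... | yes _ = *-identityˡ x
    ... | no  _ = *-identityʳ x

    h*unit : ∀ i → unit (x * enum i) ≈ h i * unit (enum i)
    h*unit i with enum i ≈? 0#
    ... | yes e≈0 = trans (ifZero-zero (trans (*-congˡ e≈0) (zeroʳ x))) (sym (*-identityˡ 1#))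
    ... | no  e≉0 = ifZero-nonzero (λ xe≈0 → e≉0 (noZeroDivisors x _ x≉0 xe≈0))

    ∏k≈x : ∏ k ≈ x
    ∏k≈x = trans (∏-single k (index 0#) others) (ifZero-zero (enum-index 0#))
      where
      others : ∀ j → j ≢ index 0# → k j ≈ 1#
      others j j≢ = ifZero-nonzero λ e≈0 → j≢ (≡.trans (≡.sym (index-enum j)) (index-cong e≈0))

    ∏units ∏h : Carrier
    ∏units = ∏ (λ i → unit (enum i))
    ∏h = ∏ h

    ∏units≈ : ∏units ≈ ∏h * ∏units
    ∏units≈ = trans (sum-permute (λ i → unit (enum i)) (times x y xy≈1))
      (trans (sum-cong-≋ (λ i → trans (unit-cong (enum-index (x * enum i))) (h*unit i)))
             (∑-distrib-+ h _))

    ∏h≈1 : ∏h ≈ 1#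
    ∏h≈1 = trans (solve 1 (λ h → h := (h :- con ℤ.1ℤ) :+ con ℤ.1ℤ) refl ∏h)
      (trans (+-congʳ (noZeroDivisors ∏units _ (∏≉0 _ (λ i → unit≉0 (enum i)))
        (trans (solve 2 (λ u h → u :* (h :- con ℤ.1ℤ) := h :* u :- u) refl ∏units ∏h)
          (trans (+-congʳ (sym ∏units≈)) (-‿inverseʳ ∏units)))))
        (+-identityˡ 1#))

    cancel : x ^ q ≈ x
    cancel = trans (sym (sum-replicate q)) (trans (sum-cong-≋ (λ i → sym (h*k≈x i)))
      (trans (∑-distrib-+ h k) (trans (*-cong ∏h≈1 ∏k≈x) (*-identityˡ x))))

  -- Otherwise `x ^ Q - x`, with leading coefficient 1, would have `Q + 1` distinct roots. Applied
  -- to an extension field, this bounds the degree of an irreducible polynomial.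
  order≤ : ∀ Q → 1 ℕ.< Q → (∀ x → x ^ Q ≈ x) → q ℕ.≤ Q
  order≤ (suc zero) (ℕ.s≤s ())
  order≤ Q@(suc (suc d)) 1<Q fixed with q ℕ.≤? Q
  ... | yes q≤Q = q≤Q
  ... | no  q≰Q = contradiction
    (sym (leading≈0 noZeroDivisors Q (PolyFn-x^d-x d)
      (λ i → enum (Fin.inject≤ i (ℕ.≰⇒> q≰Q)))
      (λ i j eq → Fin.inject≤-injective _ _ i j (enum-inj _ _ eq))
      (λ i → trans (+-congʳ (fixed _)) (-‿inverseʳ _)))) 0≉1

-- Division and irreducibility over a finite field

module FieldPolynomials {q : ℕ} (F : FiniteField q) where
  open FiniteField F hiding (zero)
  open FiniteFields F
  open Polynomials commRing
  module P = CommutativeRing polyRing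
  open IntegerCoefficientSolver polyRing

  DegreeBelow : ℕ → Poly → Set
  DegreeBelow d p = ∀ i → d ≤ i → p ! i ≈ 0#

  record Monic (d : ℕ) (p : Poly) : Set where
    constructor monic
    field
      leading : p ! d ≈ 1#
      above   : DegreeBelow (suc d) p
  open Monic public

  DegreeBelow-resp : ∀ {d p r} → p ≋ r → DegreeBelow d p → DegreeBelow d r
  DegreeBelow-resp p≋r <d i d≤i = trans (sym (coeff p≋r i)) (<d i d≤i)

  DegreeBelow-zero : ∀ {p} → DegreeBelow 0 p → p ≋ []
  DegreeBelow-zero <0 = mk≋ λ i → <0 i z≤n

  DegreeBelow-⊕ : ∀ {d} p r → DegreeBelow d p → DegreeBelow d r → DegreeBelow d (p ⊕ r)
  DegreeBelow-⊕ p r <p <r i d≤i =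
    trans (⊕-! p r i) (trans (+-cong (<p i d≤i) (<r i d≤i)) (+-identityˡ 0#))

  DegreeBelow-⊖ : ∀ {d} p → DegreeBelow d p → DegreeBelow d (⊖ p)
  DegreeBelow-⊖ p <p i d≤i = trans (⊖-! p i) (trans (-‿cong (<p i d≤i)) -0#≈0#)
    where open Algebra.Properties.Ring ring using (-0#≈0#)

  tail-DegreeBelow : ∀ {d a p} → DegreeBelow (suc d) (a ∷ p) → DegreeBelow d p
  tail-DegreeBelow <p i d≤i = <p (suc i) (s≤s d≤i)

  ⊗-! : ∀ d j f p → DegreeBelow (suc d) f → DegreeBelow (suc j) p →
        (f ⊗ p) ! (d ℕ.+ j) ≈ f ! d * p ! j
  ⊗-! d       j       []      p <f <p = sym (zeroˡ _)
  ⊗-! zero    zero    (a ∷ f) p <f <p = ⊗-!-zero a f p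
  ⊗-! zero    (suc j) (a ∷ f) p <f <p = trans (⊗-!-suc a f p j)
    (trans (+-congˡ (coeff (P.*-congʳ {p} (DegreeBelow-zero {f} (tail-DegreeBelow {a = a} <f))) j))
           (+-identityʳ _))
  ⊗-! (suc d) j       (a ∷ f) p <f <p = trans (⊗-!-suc a f p (d ℕ.+ j))
    (trans (+-cong (trans (*-congˡ (<p (suc (d ℕ.+ j)) (s≤s (ℕ.m≤n+m j d)))) (zeroʳ a))
                   (⊗-! d j f p (tail-DegreeBelow {a = a} <f) <p))
           (+-identityˡ _))

  ⊗-DegreeBelow : ∀ d j f p → DegreeBelow (suc d) f → DegreeBelow (suc j) p →
                  DegreeBelow (suc (d ℕ.+ j)) (f ⊗ p)
  ⊗-DegreeBelow d       j []      p <f <p i       _        = refl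
  ⊗-DegreeBelow zero    j (a ∷ f) p <f <p (suc i) (s≤s lt) = trans (⊗-!-suc a f p i)
    (trans (+-cong (trans (*-congˡ (<p (suc i) (s≤s lt))) (zeroʳ a))
                   (coeff (P.*-congʳ {p} (DegreeBelow-zero {f} (tail-DegreeBelow {a = a} <f))) i))
           (+-identityʳ _))
  ⊗-DegreeBelow (suc d) j (a ∷ f) p <f <p (suc i) (s≤s lt) = trans (⊗-!-suc a f p i)
    (trans (+-cong (trans (*-congˡ (<p (suc i) (s≤s (ℕ.≤-trans (ℕ.m≤n+m j (suc d)) lt)))) (zeroʳ a))
                   (⊗-DegreeBelow d j f p (tail-DegreeBelow {a = a} <f) <p i lt))
           (+-identityʳ _))

  Monic-⊗ : ∀ {d e f g} → Monic d f → Monic e g → Monic (d ℕ.+ e) (f ⊗ g)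
  Monic-⊗ {d} {e} {f} {g} (monic lf af) (monic lg ag) = monic
    (trans (⊗-! d e f g af ag) (trans (*-cong lf lg) (*-identityˡ 1#)))
    (⊗-DegreeBelow d e f g af ag)

  Monic-1 : Monic 0 (1# ∷ [])
  Monic-1 = monic refl λ { (suc i) _ → refl }

  Monic-zero : ∀ {f} → Monic 0 f → f ≋ 1# ∷ []
  Monic-zero (monic l a) = mk≋ λ { zero → l ; (suc i) → a (suc i) (s≤s z≤n) }

  record HasDegree (j : ℕ) (p : Poly) : Set where
    constructor hasDegree
    field
      leading≉0 : ¬ (p ! j ≈ 0#)
      noHigher  : DegreeBelow (suc j) p

  degree : ∀ p → p ≋ [] ⊎ ∃ λ j → HasDegree j p
  degree []      = inj₁ P.refl
  degree (a ∷ p) with degree p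
  ... | inj₂ (j , hasDegree p!j≉0 <j) =
        inj₂ (suc j , hasDegree p!j≉0 λ { (suc i) (s≤s lt) → <j i lt })
  ... | inj₁ p≋0 with a ≈? 0#
  ... | yes a≈0 = inj₁ (mk≋ λ { zero → a≈0 ; (suc i) → coeff p≋0 i })
  ... | no  a≉0 = inj₂ (0 , hasDegree a≉0 λ { (suc i) _ → coeff p≋0 i })

  degree<bound : ∀ {j d p} → HasDegree j p → DegreeBelow d p → j < d
  degree<bound {j} {d} (hasDegree p!j≉0 _) <d with j ℕ.<? d
  ... | yes j<d = j<d
  ... | no  j≮d = contradiction (<d j (ℕ.≮⇒≥ j≮d)) p!j≉0

  -- As `f` is monic, a nonzero coefficient of `p` in its degree `j` reappears in the product at
  -- degree `d + j`, which is not below `d`.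
  multiple≋0 : ∀ {d f} → Monic d f → ∀ p → DegreeBelow d (f ⊗ p) → p ≋ []
  multiple≋0 {d} {f} (monic l a) p <d with degree p
  ... | inj₁ p≋0 = p≋0
  ... | inj₂ (j , hasDegree p!j≉0 <j) = contradiction
    (trans (sym (*-identityˡ _)) (trans (*-congʳ (sym l))
      (trans (sym (⊗-! d j f p a <j)) (<d (d ℕ.+ j) (ℕ.m≤m+n d j))))) p!j≉0

  infix 4 _∣_
  record _∣_ (f p : Poly) : Set where
    constructor divides
    field
      quotient : Poly
      equality : p ≋ f ⊗ quotient

  ∣-refl : ∀ {f} → f ∣ f
  ∣-refl {f} = divides P.1# (P.sym (P.*-identityʳ f))

  ∣-trans : ∀ {f g h} → f ∣ g → g ∣ h → f ∣ h
  ∣-trans {f} (divides k g≋) (divides l h≋) =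
    divides (k ⊗ l) (P.trans h≋ (P.trans (P.*-congʳ g≋) (P.*-assoc f k l)))

  ∣-resp : ∀ {f g h} → g ≋ h → f ∣ g → f ∣ h
  ∣-resp g≋h (divides k g≋) = divides k (P.trans (P.sym g≋h) g≋)

  ∣-⊕ : ∀ {f g h} → f ∣ g → f ∣ h → f ∣ g ⊕ h
  ∣-⊕ {f} (divides k g≋) (divides l h≋) =
    divides (k ⊕ l) (P.trans (P.+-cong g≋ h≋) (P.sym (P.distribˡ f k l)))

  ∣-⊗ʳ : ∀ {f g} h → f ∣ g → f ∣ h ⊗ g
  ∣-⊗ʳ {f} h (divides k g≋) = divides (k ⊗ h) (P.trans (P.*-congˡ {h} g≋)
    (solve 3 (λ f h k → h :* (f :* k) := f :* (k :* h)) P.refl f h k))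

  scale≋⊗ : ∀ c p → scale c p ≋ (c ∷ []) ⊗ p
  scale≋⊗ c p = mk≋ λ i → sym (trans (⊕-! (scale c p) (0# ∷ []) i) (trans (+-congˡ (lemma i)) (+-identityʳ _)))
    where
    lemma : ∀ i → (0# ∷ []) ! i ≈ 0#
    lemma zero    = refl
    lemma (suc i) = refl

  divMod : ∀ {d f} → Monic d f → ∀ p → ∃₂ λ k r → p ≋ f ⊗ k ⊕ r × DegreeBelow d r
  divMod {d} {f} m []      = [] , [] ,
    P.sym (P.trans (P.+-identityʳ (f ⊗ [])) (P.zeroʳ f)) , λ _ _ → refl
  divMod {d} {f} m (a ∷ p) with divMod m p
  ... | k , r , p≋ , <d = c ∷ k , (a ∷ r) ⊕ ⊖ scale c f , eq , below
    where
    -- Shifting the old remainder `r` may create a term of degree `d`; `c` is its coefficient, and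
    -- subtracting `c f` removes it because `f` is monic.
    c = (a ∷ r) ! d
    step : a ∷ p ≋ (0# ∷ k ⊗ f) ⊕ (a ∷ r)
    step = mk≋ λ { zero    → sym (+-identityˡ a)
                 ; (suc i) → coeff (P.trans p≋ (P.+-congʳ (P.*-comm f k))) i }
    eq : a ∷ p ≋ f ⊗ (c ∷ k) ⊕ ((a ∷ r) ⊕ ⊖ scale c f)
    eq = P.trans step (P.trans
      (solve 3 (λ x y z → y :+ z := (x :+ y) :+ (z :- x)) P.refl (scale c f) (0# ∷ k ⊗ f) (a ∷ r))
      (P.+-congʳ (P.*-comm (c ∷ k) f)))
    a∷r : DegreeBelow (suc d) (a ∷ r)
    a∷r (suc i) (s≤s d≤i) = <d i d≤i
    at : ∀ i → ((a ∷ r) ⊕ ⊖ scale c f) ! i ≈ (a ∷ r) ! i - c * f ! i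
    at i = trans (⊕-! (a ∷ r) (⊖ scale c f) i)
      (+-congˡ (trans (⊖-! (scale c f) i) (-‿cong (scale-! c f i))))
    below : DegreeBelow d ((a ∷ r) ⊕ ⊖ scale c f)
    below i d≤i with ℕ.m≤n⇒m<n∨m≡n d≤i
    ... | inj₁ d<i = trans (at i) (trans (+-cong (a∷r i d<i)
            (-‿cong (trans (*-congˡ (above m i d<i)) (zeroʳ c)))) (-‿inverseʳ 0#))
    ... | inj₂ ≡.refl = trans (at d) (trans (+-congˡ (-‿cong
            (trans (*-congˡ (leading m)) (*-identityʳ c)))) (-‿inverseʳ c))

  normalise : ∀ {j p} → HasDegree j p →
              ∃₂ λ c c⁻¹ → p ≋ (c ∷ []) ⊗ ((c⁻¹ ∷ []) ⊗ p) × Monic j ((c⁻¹ ∷ []) ⊗ p)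
  normalise {j} {p} (hasDegree p!j≉0 <j) with inverse (p ! j) p!j≉0
  ... | y , cy≈1 = p ! j , y
    , P.sym (P.trans (P.sym (P.*-assoc (p ! j ∷ []) (y ∷ []) p))
        (P.trans (P.*-congʳ {p} const≋1) (P.*-identityˡ p)))
    , monic (trans (at j) (trans (*-comm y _) cy≈1))
            (λ i lt → trans (at i) (trans (*-congˡ (<j i lt)) (zeroʳ y)))
    where
    at : ∀ i → ((y ∷ []) ⊗ p) ! i ≈ y * p ! i
    at i = trans (sym (coeff (scale≋⊗ y p) i)) (scale-! y p i)
    const≋1 : (p ! j ∷ []) ⊗ (y ∷ []) ≋ 1# ∷ []
    const≋1 = mk≋ λ { zero → trans (+-identityʳ _) cy≈1 ; (suc i) → refl }

  -- The bound of the degree of the gcd by that of the first argument is what the applications rest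
  -- on: it makes the gcd a proper divisor of a second argument of larger degree.
  Bézout : ∀ (d : ℕ) (f p : Poly) → Set
  Bézout d f p = ∃₂ λ e g → e ≤ d × Monic e g × g ∣ f × g ∣ p × ∃₂ λ u v → g ≋ u ⊗ f ⊕ v ⊗ p

  bézout : ∀ d f → Monic d f → ∀ p → Bézout d f p
  bézout = <-rec _ step
    where
    step : ∀ d → (∀ {e} → e < d → ∀ f → Monic e f → ∀ p → Bézout e f p) →
           ∀ f → Monic d f → ∀ p → Bézout d f p
    step d rec f m p with divMod m p
    ... | k , r , p≋ , <d with degree r
    ... | inj₁ r≋0 = d , f , ℕ.≤-refl , m , ∣-refl
        , divides k (P.trans p≋ (P.trans (P.+-congˡ r≋0) (P.+-identityʳ _)))
        , P.1# , [] , P.sym (P.trans (P.+-identityʳ _) (P.*-identityˡ f))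
    ... | inj₂ (j , deg) with normalise deg
    ... | c , c⁻¹ , r≋ , m′ with rec (degree<bound deg <d) ((c⁻¹ ∷ []) ⊗ r) m′ f
    ... | e , g , e≤j , mg , g∣r , g∣f , u , v , g≋ = e , g
        , ℕ.≤-trans e≤j (ℕ.<⇒≤ (degree<bound deg <d)) , mg , g∣f
        , ∣-resp (P.sym p≋) (∣-⊕ (∣-resp (P.*-comm k f) (∣-⊗ʳ k g∣f))
                                 (∣-resp (P.sym r≋) (∣-⊗ʳ (c ∷ []) g∣r)))
        -- The recursive call expresses `g` by the normalised remainder and `f`; replacing `r` by
        -- `p - f k` yields these coefficients of `f` and `p`.
        , v ⊕ ⊖ (u ⊗ (c⁻¹ ∷ []) ⊗ k) , u ⊗ (c⁻¹ ∷ [])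
        , P.trans g≋ (P.trans
            (solve 6 (λ f k r u v y → u :* (y :* r) :+ v :* f
                := (v :- u :* y :* k) :* f :+ u :* y :* (f :* k :+ r)) P.refl f k r u v (c⁻¹ ∷ []))
            (P.+-congˡ {(v ⊕ ⊖ (u ⊗ (c⁻¹ ∷ []) ⊗ k)) ⊗ f} (P.*-congˡ {u ⊗ (c⁻¹ ∷ [])} (P.sym p≋))))

  polyOf : ∀ {d} → (Fin d → Carrier) → Poly
  polyOf {zero}  c = []
  polyOf {suc d} c = c zero ∷ polyOf (λ i → c (suc i))

  monicOf : ∀ {d} → (Fin d → Carrier) → Poly
  monicOf {zero}  c = 1# ∷ []
  monicOf {suc d} c = c zero ∷ monicOf (λ i → c (suc i))

  polyOf-! : ∀ {d} (c : Fin d → Carrier) i → polyOf c ! toℕ i ≈ c i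
  polyOf-! c zero    = refl
  polyOf-! c (suc i) = polyOf-! (λ i → c (suc i)) i

  polyOf-DegreeBelow : ∀ {d} (c : Fin d → Carrier) → DegreeBelow d (polyOf c)
  polyOf-DegreeBelow {zero}  c i       _         = refl
  polyOf-DegreeBelow {suc d} c (suc i) (s≤s d≤i) = polyOf-DegreeBelow (λ i → c (suc i)) i d≤i

  polyOf-≋ : ∀ {d} (c : Fin d → Carrier) p → DegreeBelow d p → (∀ i → c i ≈ p ! toℕ i) → polyOf c ≋ p
  polyOf-≋ {zero}  c p       <d eq = P.sym (DegreeBelow-zero <d)
  polyOf-≋ {suc d} c []      <d eq = mk≋ λ
    { zero    → eq zero
    ; (suc i) → coeff (polyOf-≋ (λ i → c (suc i)) [] (λ _ _ → refl) (λ i → eq (suc i))) i }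
  polyOf-≋ {suc d} c (a ∷ p) <d eq = mk≋ λ
    { zero    → eq zero
    ; (suc i) → coeff (polyOf-≋ (λ i → c (suc i)) p (tail-DegreeBelow {a = a} <d) (λ i → eq (suc i))) i }

  monicOf-Monic : ∀ {d} (c : Fin d → Carrier) → Monic d (monicOf c)
  monicOf-Monic {zero}  c = Monic-1
  monicOf-Monic {suc d} c with monicOf-Monic (λ i → c (suc i))
  ... | monic l a = monic l λ { (suc i) (s≤s lt) → a i lt }

  monicOf-≋ : ∀ {d} (c : Fin d → Carrier) p → Monic d p → (∀ i → c i ≈ p ! toℕ i) → monicOf c ≋ p
  monicOf-≋ {zero}  c p       m eq = P.sym (Monic-zero m)
  monicOf-≋ {suc d} c []      m eq = contradiction (leading m) 0≉1
  monicOf-≋ {suc d} c (a ∷ p) m eq = mk≋ λ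
    { zero    → eq zero
    ; (suc i) → coeff (monicOf-≋ (λ i → c (suc i)) p
        (monic (leading m) (tail-DegreeBelow {a = a} (above m))) (λ i → eq (suc i))) i }

  remainder-unique : ∀ {d f} → Monic d f → ∀ {p r k} → DegreeBelow d p → DegreeBelow d r →
                     p ≋ r ⊕ f ⊗ k → p ≋ r
  remainder-unique {d} {f} m {p} {r} {k} <p <r p≋ = P.trans p≋ (P.trans
      (P.+-congˡ (P.trans (P.*-congˡ {f} (multiple≋0 m k below)) (P.zeroʳ f))) (P.+-identityʳ r))
    where
    below : DegreeBelow d (f ⊗ k)
    below = DegreeBelow-resp (P.trans (P.+-congʳ p≋)
        (solve 2 (λ r x → (r :+ x) :- r := x) P.refl r (f ⊗ k)))
      (DegreeBelow-⊕ p (⊖ r) <p (DegreeBelow-⊖ r <r))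

  monic-∣? : ∀ {d g} → Monic d g → ∀ f → Dec (g ∣ f)
  monic-∣? {d} {g} m f with divMod m f
  ... | k , r , f≋ , <d with degree r
  ... | inj₁ r≋0 = yes (divides k (P.trans f≋ (P.trans (P.+-congˡ r≋0) (P.+-identityʳ _))))
  ... | inj₂ (j , hasDegree r!j≉0 _) = no λ { (divides l f≋l) → r!j≉0 (coeff
          (remainder-unique m {r} {[]} {l ⊕ ⊖ k} <d (λ _ _ → refl) (P.trans
            (solve 3 (λ g k r → r := (g :* k :+ r) :- g :* k) P.refl g k r)
            (P.trans (P.+-congʳ (P.trans (P.sym f≋) f≋l))
              (solve 3 (λ g k l → g :* l :- g :* k := con ℤ.0ℤ :+ g :* (l :- k)) P.refl g k l)))) j) }

  record Irreducible (d : ℕ) (f : Poly) : Set where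
    field
      isMonic    : Monic d f
      positive   : 0 < d
      noDivisors : ∀ e g → 0 < e → e < d → Monic e g → ¬ (g ∣ f)
  open Irreducible public

  -- Over a finite field the monic candidates of each degree are listed by their coefficient
  -- vectors, so the search for a proper divisor is decidable. A hit has smaller degree and is
  -- treated recursively; failure of the search is irreducibility.
  irreducibleFactor : ∀ d f → Monic d f → 0 < d → ∃₂ λ e g → Irreducible e g × g ∣ f
  irreducibleFactor = <-rec _ step
    where
    step : ∀ d → (∀ {e} → e < d → ∀ f → Monic e f → 0 < e → ∃₂ λ e g → Irreducible e g × g ∣ f) →
           ∀ f → Monic d f → 0 < d → ∃₂ λ e g → Irreducible e g × g ∣ f
    step d rec f m 0<d with Fin.any? (λ (e : Fin d) → (0 ℕ.<? toℕ e) ×-dec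
        Fin.any? (λ i → monic-∣? (monicOf-Monic (vector {toℕ e} i)) f))
    ... | yes (e , 0<e , i , g∣f)
      with rec (Fin.toℕ<n e) (monicOf (vector {toℕ e} i)) (monicOf-Monic (vector i)) 0<e
    ...   | e′ , g′ , irr , g′∣g = e′ , g′ , irr , ∣-trans g′∣g g∣f
    step d rec f m 0<d | no none = d , f , record
        { isMonic = m ; positive = 0<d
        ; noDivisors = λ e g 0<e e<d mg g∣f → none (divisor e g 0<e e<d mg g∣f) } , ∣-refl
      where
      divisor : ∀ e g → 0 < e → e < d → Monic e g → g ∣ f →
                ∃ λ (e : Fin d) → 0 < toℕ e × ∃ λ i → monicOf (vector {toℕ e} i) ∣ f
      divisor e g 0<e e<d mg (divides k f≋) = fromℕ< e<d
        , ≡.subst (λ e′ → 0 < e′ × ∃ λ i → monicOf (vector {e′} i) ∣ f)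
            (≡.sym (Fin.toℕ-fromℕ< e<d))
            (0<e , vectorIndex c , divides k (P.trans f≋ (P.*-congʳ {k} (P.sym
              (monicOf-≋ (vector (vectorIndex c)) g mg (vector-vectorIndex c))))))
        where
        c : Fin e → Carrier
        c i = g ! toℕ i

  module Extension {d : ℕ} {f : Poly} (irreducible : Irreducible d f) where
    open PrincipalQuotient polyRing f

    ≈ᶠ⇒≋ : ∀ {p r} → DegreeBelow d p → DegreeBelow d r → p ≈ᶠ r → p ≋ r
    ≈ᶠ⇒≋ <p <r (k ,ᶠ eq) = remainder-unique (isMonic irreducible) <p <r eq

    1-DegreeBelow : DegreeBelow d (1# ∷ [])
    1-DegreeBelow (suc i) _ = refl
    1-DegreeBelow zero    d≤0 = contradiction (ℕ.≤-trans (positive irreducible) d≤0) λ ()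

    -- The gcd of `f` with the remainder of `p` has degree below `d`, so irreducibility forces it to
    -- be 1, and the Bézout coefficient of the remainder inverts `p` modulo `f`.
    inverseᶠ : ∀ p → ¬ (p ≈ᶠ []) → ∃ λ r → p ⊗ r ≈ᶠ 1# ∷ []
    inverseᶠ p p≉0 with divMod (isMonic irreducible) p
    ... | k , r , p≋ , <d with degree r
    ... | inj₁ r≋0 = contradiction
          (k ,ᶠ P.trans p≋ (P.trans (P.+-comm (f ⊗ k) r) (P.+-congʳ r≋0))) p≉0
    ... | inj₂ (j , deg) with normalise deg
    ... | c , y , r≋ , m with bézout j _ m f
    ... | suc e , g , e≤j , mg , g∣r , g∣f , _ = contradiction g∣f
          (noDivisors irreducible (suc e) g (s≤s z≤n)
            (ℕ.≤-<-trans e≤j (degree<bound deg <d)) mg)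
    ... | zero , g , _ , mg , _ , _ , u , v , g≋ = u ⊗ (y ∷ []) , (u ⊗ (y ∷ []) ⊗ k ⊕ ⊖ v) ,ᶠ
          P.trans (P.*-congʳ p≋) (P.trans
            (solve 6 (λ f k r u v y → (f :* k :+ r) :* (u :* y)
                := (u :* (y :* r) :+ v :* f) :+ f :* (u :* y :* k :- v)) P.refl f k r u v (y ∷ []))
            (P.+-congʳ {f ⊗ (u ⊗ (y ∷ []) ⊗ k ⊕ ⊖ v)} (P.trans (P.sym g≋) (Monic-zero mg))))

    extension : FiniteField (q ℕ.^ d)
    extension = record
      { commRing  = quotientRing
      ; 0≉1       = λ 0≈1 → 0≉1 (coeff (≈ᶠ⇒≋ (λ _ _ → refl) 1-DegreeBelow 0≈1) 0)
      ; inverse   = inverseᶠ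
      ; enum      = λ i → polyOf (vector {d} i)
      ; enum-surj = surjective
      ; enum-inj  = λ i j eq → vector-injective i j (λ k →
          trans (sym (polyOf-! (vector {d} i) k))
          (trans (coeff (≈ᶠ⇒≋ (polyOf-DegreeBelow (vector {d} i)) (polyOf-DegreeBelow (vector {d} j)) eq) (toℕ k))
                 (polyOf-! (vector {d} j) k)))
      }
      where
      surjective : ∀ p → ∃ λ i → polyOf (vector {d} i) ≈ᶠ p
      surjective p with divMod (isMonic irreducible) p
      ... | k , r , p≋ , <d = vectorIndex c , (⊖ k) ,ᶠ
          P.trans (polyOf-≋ (vector (vectorIndex c)) r <d (vector-vectorIndex c))
          (P.trans (solve 3 (λ f k r → r := (f :* k :+ r) :+ f :* :- k) P.refl f k r)
                   (P.+-congʳ (P.sym p≋)))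
        where
        c : Fin d → Carrier
        c i = r ! toℕ i

-- Irreducible polynomials of every degree

module IrreducibleExistence {q : ℕ} (F : FiniteField q) where
  open FiniteField F hiding (zero)
  open FiniteFields F
  open Polynomials commRing
  open FieldPolynomials F
  open PolynomialFunctions commRing
  open IntegerCoefficientSolver polyRing
  open Algebra.Properties.Semiring.Exp semiring using (_^_)
  open Algebra.Properties.CommutativeSemiring.Exp P.commutativeSemiring using ()
    renaming (_^_ to _⊗^_; ^-congˡ to ⊗^-congˡ; ^-assocʳ to ⊗^-assocʳ; ^-distrib-* to ⊗^-distrib-⊗)

  id-homo : IsRingHomomorphism rawRing rawRing id
  id-homo = record
    { isSemiringHomomorphism = record
      { isNearSemiringHomomorphism = record
        { +-isMonoidHomomorphism = record
          { isMagmaHomomorphism = record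
            { isRelHomomorphism = record { cong = id }
            ; homo = λ _ _ → refl }
          ; ε-homo = refl }
        ; *-homo = λ _ _ → refl }
      ; 1#-homo = refl }
    ; -‿homo = λ _ → refl }

  constant : Carrier → Poly
  constant a = a ∷ []

  constant-cong : ∀ {a b} → a ≈ b → constant a ≋ constant b
  constant-cong a≈b = mk≋ λ { zero → a≈b ; (suc i) → refl }

  constant-⊗ : ∀ a b → constant (a * b) ≋ constant a ⊗ constant b
  constant-⊗ a b = mk≋ λ { zero → sym (+-identityʳ _) ; (suc i) → refl }

  constant-0 : constant 0# ≋ []
  constant-0 = mk≋ λ { zero → refl ; (suc i) → refl }

  constant-homo : IsRingHomomorphism rawRing P.rawRing constant
  constant-homo = record
    { isSemiringHomomorphism = record
      { isNearSemiringHomomorphism = record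
        { +-isMonoidHomomorphism = record
          { isMagmaHomomorphism = record
            { isRelHomomorphism = record { cong = constant-cong }
            ; homo = λ _ _ → P.refl }
          ; ε-homo = constant-0 }
        ; *-homo = constant-⊗ }
      ; 1#-homo = P.refl }
    ; -‿homo = λ _ → P.refl }

  module E = Evaluation commRing commRing id id-homo
  module C = Evaluation commRing polyRing constant constant-homo

  eval-PolyFn : ∀ d p → DegreeBelow (suc d) p → PolyFn d (p ! d) (λ x → E.eval x p)
  eval-PolyFn zero    []      <d x = refl
  eval-PolyFn (suc d) []      <d   = PolyFn-const d 0#
  eval-PolyFn zero    (a ∷ p) <d x =
    trans (+-congˡ (trans (*-congˡ (E.eval-≋0 x p (DegreeBelow-zero (tail-DegreeBelow {a = a} <d)))) (zeroʳ x)))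
          (+-identityʳ a)
  eval-PolyFn (suc d) (a ∷ p) <d   = PolyFn-resp (suc d) (+-identityˡ _)
    (PolyFn-+ (suc d) (PolyFn-const d a)
                      (PolyFn-x* d (eval-PolyFn d p (tail-DegreeBelow {a = a} <d))))

  -- As long as the degree is below `q`, the elements of the field are more roots than the degree
  -- allows, which kills the top coefficient; the others follow in descending order.
  vanishing≋0 : ∀ d p → d ≤ q → DegreeBelow d p → (∀ x → E.eval x p ≈ 0#) → p ≋ []
  vanishing≋0 zero    p d≤q <d eval≈0 = DegreeBelow-zero <d
  vanishing≋0 (suc d) p d≤q <d eval≈0 = vanishing≋0 d p (ℕ.<⇒≤ d≤q) below eval≈0
    where
    p!d≈0 : p ! d ≈ 0#
    p!d≈0 = leading≈0 noZeroDivisors d (eval-PolyFn d p <d)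
      (λ i → enum (Fin.inject≤ i d≤q))
      (λ i j eq → Fin.inject≤-injective _ _ i j (enum-inj _ _ eq)) (λ i → eval≈0 _)
    below : DegreeBelow d p
    below i d≤i with ℕ.m≤n⇒m<n∨m≡n d≤i
    ... | inj₁ d<i    = <d i d<i
    ... | inj₂ ≡.refl = p!d≈0

  X : Poly
  X = 0# ∷ 1# ∷ []

  X-⊗ : ∀ p → X ⊗ p ≋ 0# ∷ p
  X-⊗ p = mk≋ λ
    { zero    → trans (⊗-!-zero 0# (1# ∷ []) p) (zeroˡ _)
    ; (suc i) → trans (⊗-!-suc 0# (1# ∷ []) p i)
        (trans (+-cong (zeroˡ _) (coeff (P.*-identityˡ p) i)) (+-identityˡ _)) }

  Monic-⊗^ : ∀ {d p} n → Monic d p → Monic (n ℕ.* d) (p ⊗^ n)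
  Monic-⊗^ zero    m = Monic-1
  Monic-⊗^ (suc n) m = Monic-⊗ m (Monic-⊗^ n m)

  Monic-X : Monic 1 X
  Monic-X = monic refl λ { (suc zero) (s≤s ()) ; (suc (suc i)) _ → refl }

  Monic-X^ : ∀ n → Monic n (X ⊗^ n)
  Monic-X^ n = ≡.subst (λ d → Monic d (X ⊗^ n)) (ℕ.*-identityʳ n) (Monic-⊗^ n Monic-X)

  Monic-1+X^ : ∀ n → Monic n ((P.1# ⊕ X) ⊗^ n)
  Monic-1+X^ n = ≡.subst (λ d → Monic d ((P.1# ⊕ X) ⊗^ n)) (ℕ.*-identityʳ n)
    (Monic-⊗^ n (monic refl λ { (suc zero) (s≤s ()) ; (suc (suc i)) _ → refl }))

  private
    0<q : 0 < q
    0<q = ℕ.<⇒≤ 1<q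

    instance
      q≢0 : ℕ.NonZero q
      q≢0 = ℕ.>-nonZero 0<q

  -- The difference of both sides has degree below q and vanishes on F.
  [1+X]^q : (P.1# ⊕ X) ⊗^ q ≋ P.1# ⊕ X ⊗^ q
  [1+X]^q = P.trans (solve 2 (λ x y → x := (x :- y) :+ y) P.refl lhs rhs)
    (P.trans (P.+-congʳ {rhs} (vanishing≋0 q (lhs ⊕ ⊖ rhs) ℕ.≤-refl below eval≈0)) (P.+-identityˡ rhs))
    where
    lhs rhs : Poly
    lhs = (P.1# ⊕ X) ⊗^ q
    rhs = P.1# ⊕ X ⊗^ q

    Monic-rhs : Monic q rhs
    Monic-rhs = monic
      (trans (⊕-! P.1# (X ⊗^ q) q) (trans (+-cong (1-below q 0<q) (leading (Monic-X^ q))) (+-identityˡ 1#)))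
      (λ i q<i → trans (⊕-! P.1# (X ⊗^ q) i)
        (trans (+-cong (1-below i (ℕ.≤-trans (s≤s z≤n) q<i)) (above (Monic-X^ q) i q<i)) (+-identityˡ 0#)))
      where
      1-below : ∀ i → 0 < i → P.1# ! i ≈ 0#
      1-below (suc i) _ = refl

    below : DegreeBelow q (lhs ⊕ ⊖ rhs)
    below i q≤i = trans (⊕-! lhs (⊖ rhs) i) (trans (+-congˡ (⊖-! rhs i)) (cancel (ℕ.m≤n⇒m<n∨m≡n q≤i)))
      where
      cancel : q < i ⊎ q ≡ i → lhs ! i - rhs ! i ≈ 0#
      cancel (inj₁ q<i)    = trans (+-cong (above (Monic-1+X^ q) i q<i)
                                           (-‿cong (above Monic-rhs i q<i))) (-‿inverseʳ 0#)
      cancel (inj₂ ≡.refl) = trans (+-cong (leading (Monic-1+X^ q))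
                                           (-‿cong (leading Monic-rhs))) (-‿inverseʳ 1#)

    eval-X : ∀ x → E.eval x X ≈ x
    eval-X x = trans (+-identityˡ _) (trans (*-congˡ (E.eval-1 x)) (*-identityʳ x))

    eval-lhs : ∀ x → E.eval x lhs ≈ 1# + x
    eval-lhs x = trans (E.eval-^ x (P.1# ⊕ X) q) (trans (fermat _)
      (trans (E.eval-⊕ x P.1# X) (+-cong (E.eval-1 x) (eval-X x))))

    eval-rhs : ∀ x → E.eval x rhs ≈ 1# + x
    eval-rhs x = trans (E.eval-⊕ x P.1# (X ⊗^ q)) (+-cong (E.eval-1 x)
      (trans (E.eval-^ x X q) (trans (fermat _) (eval-X x))))

    eval≈0 : ∀ x → E.eval x (lhs ⊕ ⊖ rhs) ≈ 0#
    eval≈0 x = ∙-cancelʳ (E.eval x rhs) _ 0# (trans (sym (E.eval-⊕ x (lhs ⊕ ⊖ rhs) rhs))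
      (trans (E.eval-cong x (solve 2 (λ x y → (x :- y) :+ y := x) P.refl lhs rhs))
        (trans (eval-lhs x) (trans (sym (eval-rhs x)) (sym (+-identityˡ _))))))
      where open Algebra.Properties.Group +-group using (∙-cancelʳ)

  -- The identity `[1+X]^q` holds between polynomials, not just between functions, so `p` may be
  -- substituted for `X` by evaluating along the constant embedding.
  [1+p]^q : ∀ p → (P.1# ⊕ p) ⊗^ q ≋ P.1# ⊕ p ⊗^ q
  [1+p]^q p = P.trans (⊗^-congˡ q (P.sym evalˡ)) (P.trans (P.sym (C.eval-^ p (P.1# ⊕ X) q))
    (P.trans (C.eval-cong p [1+X]^q) (P.trans (C.eval-⊕ p P.1# (X ⊗^ q))
      (P.+-cong (C.eval-1 p) (P.trans (C.eval-^ p X q) (⊗^-congˡ q eval-X))))))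
    where
    eval-X : C.eval p X ≋ p
    eval-X = P.trans (P.+-cong constant-0 (P.*-congˡ {p} (C.eval-1 p))) (P.*-identityʳ p)
    evalˡ : C.eval p (P.1# ⊕ X) ≋ P.1# ⊕ p
    evalˡ = P.trans (C.eval-⊕ p P.1# X) (P.+-cong (C.eval-1 p) eval-X)

  constant-⊗^ : ∀ a n → constant a ⊗^ n ≋ constant (a ^ n)
  constant-⊗^ a zero    = P.refl
  constant-⊗^ a (suc n) = P.trans (P.*-congˡ {constant a} (constant-⊗^ a n)) (P.sym (constant-⊗ a (a ^ n)))

  -- For nonzero `a`, factor it out to reach the case `a = 1`; `fermat` then turns `a ^ q` back into
  -- `a`.
  [a+p]^q : ∀ a p → (constant a ⊕ p) ⊗^ q ≋ constant a ⊕ p ⊗^ q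
  [a+p]^q a p with a ≈? 0#
  ... | yes a≈0 = P.trans (⊗^-congˡ q (drop p)) (P.sym (drop (p ⊗^ q)))
    where
    drop : ∀ r → constant a ⊕ r ≋ r
    drop r = P.+-congʳ {r} (P.trans (constant-cong a≈0) constant-0)
  ... | no  a≉0 with inverse a a≉0
  ... | b , ab≈1 = P.trans (⊗^-congˡ q factor) (P.trans (⊗^-distrib-⊗ A (P.1# ⊕ B ⊗ p) q)
    (P.trans (P.*-congˡ {A ⊗^ q} ([1+p]^q (B ⊗ p))) (P.trans (P.distribˡ (A ⊗^ q) P.1# ((B ⊗ p) ⊗^ q))
    (P.+-cong (P.trans (P.*-identityʳ (A ⊗^ q)) (P.trans (constant-⊗^ a q) (constant-cong (fermat a))))
      (P.trans (P.sym (⊗^-distrib-⊗ A (B ⊗ p) q))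
        (⊗^-congˡ q (P.trans (P.sym (P.*-assoc A B p)) (P.trans (P.*-congʳ {p} AB≋1) (P.*-identityˡ p)))))))))
    where
    A B : Poly
    A = constant a
    B = constant b
    AB≋1 : A ⊗ B ≋ P.1#
    AB≋1 = P.trans (P.sym (constant-⊗ a b)) (constant-cong ab≈1)
    factor : A ⊕ p ≋ A ⊗ (P.1# ⊕ B ⊗ p)
    factor = P.sym (P.trans (solve 3 (λ a b p → a :* (con ℤ.1ℤ :+ b :* p) := a :+ (a :* b) :* p) P.refl A B p)
      (P.+-congˡ {A} (P.trans (P.*-congʳ {p} AB≋1) (P.*-identityˡ p))))

  [a+p]^q^ : ∀ m a p → (constant a ⊕ p) ⊗^ (q ℕ.^ m) ≋ constant a ⊕ p ⊗^ (q ℕ.^ m)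
  [a+p]^q^ zero    a p = P.trans (P.*-identityʳ (constant a ⊕ p)) (P.+-congˡ {constant a} (P.sym (P.*-identityʳ p)))
  [a+p]^q^ (suc m) a p = P.trans (P.sym (⊗^-assocʳ (constant a ⊕ p) q (q ℕ.^ m)))
    (P.trans (⊗^-congˡ (q ℕ.^ m) ([a+p]^q a p))
    (P.trans ([a+p]^q^ m a (p ⊗^ q)) (P.+-congˡ {constant a} (⊗^-assocʳ p q (q ℕ.^ m)))))

  X^q^-X : ℕ → Poly
  X^q^-X m = X ⊗^ (q ℕ.^ m) ⊕ ⊖ X

  -- Induction on the coefficient list: the power splits off the constant term unchanged and is
  -- multiplicative on `X ⊗ p`. Hence any `f` dividing `X^q^-X m` makes the `q ^ m`-th power the
  -- identity modulo `f`. Both the degree bound and squarefreeness below come from this.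
  frobenius : ∀ m p → ∃ λ k → p ⊗^ (q ℕ.^ m) ≋ p ⊕ X^q^-X m ⊗ k
  frobenius m []      = [] , P.trans ([]^ (ℕ.m^n>0 q m)) (P.sym (P.zeroʳ (X^q^-X m)))
    where
    []^ : ∀ {n} → 0 < n → [] ⊗^ n ≋ []
    []^ {suc n} _ = P.refl
  frobenius m (a ∷ p) with frobenius m p
  -- With `H` for `Xᵠ - X`, this witness is read off from `Xᵠ (p + H k) = X p + H (Xᵠ k + p)`.
  ... | k , p^Q≋ = Xᵠ ⊗ k ⊕ p , P.trans (⊗^-congˡ Q split) (P.trans ([a+p]^q^ m a (X ⊗ p))
      (P.trans (P.+-congˡ {A} (P.trans (⊗^-distrib-⊗ X p Q) (P.*-congˡ {Xᵠ} p^Q≋)))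
      (P.trans (solve 5 (λ a x xq p k → a :+ xq :* (p :+ (xq :- x) :* k)
                          := (a :+ x :* p) :+ (xq :- x) :* (xq :* k :+ p)) P.refl A X Xᵠ p k)
               (P.+-congʳ (P.sym split)))))
    where
    Q = q ℕ.^ m
    Xᵠ = X ⊗^ Q
    A = constant a
    split : a ∷ p ≋ A ⊕ X ⊗ p
    split = P.trans (mk≋ λ { zero → sym (+-identityʳ a) ; (suc i) → refl }) (P.+-congˡ {A} (P.sym (X-⊗ p)))

  Monic-X^q^-X : ∀ m → 0 < m → Monic (q ℕ.^ m) (X^q^-X m)
  Monic-X^q^-X m 0<m = monic
    (trans (at Q) (trans (+-cong (leading (Monic-X^ Q)) (X-above Q 1<Q)) (+-identityʳ 1#)))
    (λ i Q<i → trans (at i) (trans (+-cong (above (Monic-X^ Q) i Q<i) (X-above i (ℕ.<-trans 1<Q Q<i)))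
                                   (+-identityʳ 0#)))
    where
    Q = q ℕ.^ m
    1<Q : 1 < Q
    1<Q = ℕ.^-monoʳ-< q 1<q 0<m
    at : ∀ i → X^q^-X m ! i ≈ (X ⊗^ Q) ! i + (⊖ X) ! i
    at = ⊕-! (X ⊗^ Q) (⊖ X)
    X-above : ∀ i → 1 < i → (⊖ X) ! i ≈ 0#
    X-above (suc zero)    (s≤s ())
    X-above (suc (suc i)) _ = refl

  module _ {e : ℕ} {f : Poly} (irreducible : Irreducible e f) where
    open Extension irreducible
    open PrincipalQuotient polyRing f
    private
      module K = FiniteField extension
      open Algebra.Properties.Semiring.Exp K.semiring using () renaming (_^_ to _^ᴷ_)

      ^ᴷ≡⊗^ : ∀ p n → p ^ᴷ n ≡ p ⊗^ n
      ^ᴷ≡⊗^ p zero    = ≡.refl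
      ^ᴷ≡⊗^ p (suc n) = ≡.cong (p ⊗_) (^ᴷ≡⊗^ p n)

    -- By `frobenius` every element of the extension field, which has `q ^ e` elements, is fixed by
    -- the `q ^ m`-th power; `order≤` then compares the two exponents.
    ∣X^q^-X⇒≤ : ∀ m → 0 < m → f ∣ X^q^-X m → e ≤ m
    ∣X^q^-X⇒≤ m 0<m (divides l H≋) with e ℕ.≤? m
    ... | yes e≤m = e≤m
    ... | no  e≰m = contradiction (FiniteFields.order≤ extension (q ℕ.^ m) (ℕ.^-monoʳ-< q 1<q 0<m) fixed)
                                  (ℕ.<⇒≱ (ℕ.^-monoʳ-< q 1<q (ℕ.≰⇒> e≰m)))
      where
      fixed : ∀ p → p ^ᴷ (q ℕ.^ m) ≈ᶠ p
      fixed p with frobenius m p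
      ... | k , p^Q≋ = (l ⊗ k) ,ᶠ P.trans (P.reflexive (^ᴷ≡⊗^ p (q ℕ.^ m)))
        (P.trans p^Q≋ (P.+-congˡ {p} (P.trans (P.*-congʳ {k} H≋) (P.*-assoc f l k))))

    ≈ᶠ⇒∣ : ∀ {p r} → p ≈ᶠ r → f ∣ p ⊕ ⊖ r
    ≈ᶠ⇒∣ {p} {r} (k ,ᶠ p≋) = divides k (P.trans (P.+-congʳ {⊖ r} p≋)
      (solve 2 (λ x y → (x :+ y) :- x := y) P.refl r (f ⊗ k)))

    ∣X^q^-X : f ∣ X^q^-X e
    ∣X^q^-X = ≡.subst (λ p → f ∣ p ⊕ ⊖ X) (^ᴷ≡⊗^ X (q ℕ.^ e)) (≈ᶠ⇒∣ (FiniteFields.fermat extension X))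

    -- In place of a derivative, `frobenius` is applied to `f` itself: if `f ⊗ f` divided
    -- `X^q^-X m`, then `f ⊗^ (q ℕ.^ m)` would be `f` plus a multiple of `f ⊗ f`. Since `q ^ m` is
    -- at least 2, cancelling one `f` would make it a divisor of 1.
    square∤X^q^-X : ∀ m → 0 < m → ¬ (f ⊗ f ∣ X^q^-X m)
    square∤X^q^-X m 0<m (divides l H≋) with q ℕ.^ m | ℕ.^-monoʳ-< q 1<q 0<m | frobenius m f
    ... | suc zero    | s≤s () | _
    ... | suc (suc n) | _      | k , f^Q≋ =
        0≉1 (trans (sym (coeff (P.trans (P.*-congˡ {f} z≋0) (P.zeroʳ f)) 0)) (coeff (P.sym 1≋fz) 0))
      where
      z : Poly
      z = f ⊗^ n ⊕ ⊖ (l ⊗ k)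
      f[1-fz]≋0 : f ⊗ (P.1# ⊕ ⊖ (f ⊗ z)) ≋ []
      f[1-fz]≋0 = P.trans
        (solve 4 (λ f p l k → f :* (con ℤ.1ℤ :- f :* (p :- l :* k)) := (f :+ f :* f :* l :* k) :- f :* (f :* p))
          P.refl f (f ⊗^ n) l k)
        (P.trans (P.+-congʳ (P.trans (P.+-congˡ {f} (P.*-congʳ {k} (P.sym H≋))) (P.sym f^Q≋)))
                 (P.-‿inverseʳ (f ⊗ (f ⊗ (f ⊗^ n)))))
      1≋fz : P.1# ≋ f ⊗ z
      1≋fz = P.trans (solve 1 (λ x → con ℤ.1ℤ := (con ℤ.1ℤ :- x) :+ x) P.refl (f ⊗ z))
        (P.+-congʳ {f ⊗ z} (multiple≋0 (isMonic irreducible) (P.1# ⊕ ⊖ (f ⊗ z))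
          (λ i _ → coeff f[1-fz]≋0 i)))
      z≋0 : z ≋ []
      z≋0 = multiple≋0 (isMonic irreducible) z (DegreeBelow-resp 1≋fz 1-DegreeBelow)

  quotient-Monic : ∀ {N d h f k} → Monic N h → Monic d f → d < N → h ≋ f ⊗ k → ∃ λ j → 0 < j × Monic j k
  quotient-Monic {N} {d} {h} {f} {k} mh mf d<N h≋ with degree k
  ... | inj₁ k≋0 = contradiction (trans (sym (coeff (P.trans h≋ (P.trans (P.*-congˡ {f} k≋0) (P.zeroʳ f))) N))
                                        (leading mh)) 0≉1
  ... | inj₂ (j , hasDegree k!j≉0 <j) with ℕ.<-cmp (d ℕ.+ j) N
  ... | tri< lt _ _ = contradiction (trans (sym (⊗-DegreeBelow d j f k (above mf) <j N lt))
                        (trans (sym (coeff h≋ N)) (leading mh))) 0≉1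

  ... | tri> _ _ gt = contradiction (trans (sym (*-identityˡ _)) (trans (*-congʳ (sym (leading mf)))
                        (trans (sym (⊗-! d j f k (above mf) <j))
                        (trans (sym (coeff h≋ (d ℕ.+ j))) (above mh (d ℕ.+ j) gt))))) k!j≉0
  ... | tri≈ _ ≡.refl _ = j , positive′ j d<N
      , monic (trans (sym (*-identityˡ _)) (trans (*-congʳ (sym (leading mf)))
          (trans (sym (⊗-! d j f k (above mf) <j)) (trans (sym (coeff h≋ (d ℕ.+ j))) (leading mh))))) <j
    where
    positive′ : ∀ j → d < d ℕ.+ j → 0 < j
    positive′ zero    d<d = contradiction (≡.subst (d <_) (ℕ.+-identityʳ d) d<d) (ℕ.<-irrefl ≡.refl)
    positive′ (suc j) _   = s≤s z≤n

  ∏X^q^-X : ℕ → Poly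
  ∏X^q^-X zero    = P.1#
  ∏X^q^-X (suc d) = ∏X^q^-X d ⊗ X^q^-X (suc d)

  ∑q^ : ℕ → ℕ
  ∑q^ zero    = 0
  ∑q^ (suc d) = ∑q^ d ℕ.+ q ℕ.^ suc d

  ∑q^<q^ : ∀ d → ∑q^ d < q ℕ.^ suc d
  ∑q^<q^ zero    = ℕ.m^n>0 q 1
  ∑q^<q^ (suc d) = ℕ.<-≤-trans (ℕ.+-monoˡ-< (q ℕ.^ suc d) (∑q^<q^ d))
    (ℕ.≤-trans (ℕ.≤-reflexive (≡.cong (q ℕ.^ suc d ℕ.+_) (≡.sym (ℕ.+-identityʳ _))))
               (ℕ.*-monoˡ-≤ (q ℕ.^ suc d) 1<q))

  Monic-∏ : ∀ d → Monic (∑q^ d) (∏X^q^-X d)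
  Monic-∏ zero    = Monic-1
  Monic-∏ (suc d) = Monic-⊗ (Monic-∏ d) (Monic-X^q^-X (suc d) (s≤s z≤n))

  X^q^-X∣∏ : ∀ e d → 0 < e → e ≤ d → X^q^-X e ∣ ∏X^q^-X d
  X^q^-X∣∏ (suc e) (suc d) 0<e e≤d with ℕ.m≤n⇒m<n∨m≡n e≤d
  ... | inj₁ (s≤s e<d) = ∣-resp (P.*-comm (X^q^-X (suc d)) (∏X^q^-X d))
                           (∣-⊗ʳ (X^q^-X (suc d)) (X^q^-X∣∏ (suc e) d 0<e e<d))
  ... | inj₂ ≡.refl    = ∣-⊗ʳ (∏X^q^-X d) ∣-refl

  -- The gcd `D` of `X^q^-X (suc m)` with the product takes the place of a full factorisation. Its
  -- cofactor `g` has positive degree; an irreducible factor `f` of `g` of degree at most `m` would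
  -- also divide the product, hence `D`, and so occur twice in `D ⊗ g`.
  irreducible-exists : ∀ m → ∃ (Irreducible (suc m))
  irreducible-exists m with bézout (∑q^ m) (∏X^q^-X m) (Monic-∏ m) (X^q^-X (suc m))
  ... | d , D , d≤ , mD , D∣∏ , divides g H≋ , u , v , D≋
    with quotient-Monic (Monic-X^q^-X (suc m) (s≤s z≤n)) mD (ℕ.≤-<-trans d≤ (∑q^<q^ m)) H≋
  ... | j , 0<j , mg with irreducibleFactor j g mg 0<j
  ... | e , f , irr , f∣g@(divides k g≋) with ∣-trans f∣g (divides D (P.trans H≋ (P.*-comm D g)))
  ... | f∣H with ℕ.m≤n⇒m<n∨m≡n (∣X^q^-X⇒≤ irr (suc m) (s≤s z≤n) f∣H)
  ... | inj₂ ≡.refl    = f , irr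
  ... | inj₁ (s≤s e≤m) = contradiction (ff∣H f∣D) (square∤X^q^-X irr (suc m) (s≤s z≤n))
    where
    f∣D : f ∣ D
    f∣D = ∣-resp (P.sym D≋) (∣-⊕ (∣-⊗ʳ u (∣-trans (∣X^q^-X irr) (X^q^-X∣∏ e m (positive irr) e≤m)))
                                 (∣-⊗ʳ v f∣H))
    ff∣H : f ∣ D → f ⊗ f ∣ X^q^-X (suc m)
    ff∣H (divides l D≋fl) = divides (l ⊗ k) (P.trans H≋ (P.trans (P.*-cong D≋fl g≋)
      (solve 3 (λ f k l → (f :* l) :* (f :* k) := (f :* f) :* (l :* k)) P.refl f k l)))

-- Construction of large partial spreads

module LinearAlgebra {q : ℕ} (F : FiniteField q) where
  open FiniteField F hiding (zero)
  open Algebra.Properties.Semiring.Sum semiring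
    using (sum; sum-cong-≋; sum-replicate-zero; ∑-distrib-+; *-distribˡ-sum)
  open SingleTerm +-commutativeMonoid

  ∑≡sum : ∀ n (f : Fin n → Carrier) → ∑ F n f ≡ sum f
  ∑≡sum zero    f = ≡.refl
  ∑≡sum (suc n) f = ≡.cong (f zero +_) (∑≡sum n (λ i → f (suc i)))

  ∑-cong : ∀ n {f g : Fin n → Carrier} → (∀ i → f i ≈ g i) → ∑ F n f ≈ ∑ F n g
  ∑-cong n {f} {g} f≈g = trans (reflexive (∑≡sum n f))
    (trans (sum-cong-≋ f≈g) (reflexive (≡.sym (∑≡sum n g))))

  ∑-0 : ∀ n {f : Fin n → Carrier} → (∀ i → f i ≈ 0#) → ∑ F n f ≈ 0#
  ∑-0 n {f} f≈0 = trans (reflexive (∑≡sum n f)) (trans (sum-cong-≋ f≈0) (sum-replicate-zero n))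

  ∑-+ : ∀ n (f g : Fin n → Carrier) → ∑ F n (λ i → f i + g i) ≈ ∑ F n f + ∑ F n g
  ∑-+ n f g = trans (reflexive (∑≡sum n _)) (trans (∑-distrib-+ f g)
    (sym (+-cong (reflexive (∑≡sum n f)) (reflexive (∑≡sum n g)))))

  ∑-* : ∀ n a (f : Fin n → Carrier) → ∑ F n (λ i → a * f i) ≈ a * ∑ F n f
  ∑-* n a f = trans (reflexive (∑≡sum n _)) (trans (sym (*-distribˡ-sum a f))
    (*-congˡ (reflexive (≡.sym (∑≡sum n f)))))

  ∑-single : ∀ n (f : Fin n → Carrier) i → (∀ j → j ≢ i → f j ≈ 0#) → ∑ F n f ≈ f i
  ∑-single n f i others = trans (reflexive (∑≡sum n f)) (sum-single f i others)

  δ : ∀ {n} → Fin n → Fin n → Carrier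
  δ i j with i Fin.≟ j
  ... | yes _ = 1#
  ... | no  _ = 0#

  δ-same : ∀ {n} (i : Fin n) → δ i i ≈ 1#
  δ-same i with i Fin.≟ i
  ... | yes _   = refl
  ... | no  i≢i = contradiction ≡.refl i≢i

  δ-distinct : ∀ {n} {i j : Fin n} → i ≢ j → δ i j ≈ 0#
  δ-distinct {i = i} {j} i≢j with i Fin.≟ j
  ... | yes i≡j = contradiction i≡j i≢j
  ... | no  _   = refl

  ∑-δʳ : ∀ n (c : Fin n → Carrier) j → ∑ F n (λ i → c i * δ i j) ≈ c j
  ∑-δʳ n c j = trans (∑-single n _ j (λ i i≢j → trans (*-congˡ (δ-distinct i≢j)) (zeroʳ _)))
    (trans (*-congˡ (δ-same j)) (*-identityʳ _))

  lincomb-0 : ∀ {n t} {c : Fin t → Carrier} (U : Fin t → Vector F n) → (∀ i → c i ≈ 0#) →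
              IsZeroVec F (lincomb F c U)
  lincomb-0 {t = t} U c≈0 k = ∑-0 t (λ i → trans (*-congʳ (c≈0 i)) (zeroˡ _))

  lincomb-++ˡ : ∀ {m n t} (c : Fin t → Carrier) (U : Fin t → Vector F m) (V : Fin t → Vector F n) k →
                lincomb F c (λ i → U i ++ V i) (k ↑ˡ n) ≈ lincomb F c U k
  lincomb-++ˡ {t = t} c U V k = ∑-cong t λ i → *-congˡ (reflexive (Vector.lookup-++ˡ (U i) (V i) k))

  lincomb-++ʳ : ∀ {m n t} (c : Fin t → Carrier) (U : Fin t → Vector F m) (V : Fin t → Vector F n) k →
                lincomb F c (λ i → U i ++ V i) (m ↑ʳ k) ≈ lincomb F c V k
  lincomb-++ʳ {t = t} c U V k = ∑-cong t λ i → *-congˡ (reflexive (Vector.lookup-++ʳ (U i) (V i) k))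

module SpreadConstruction {q : ℕ} (F : FiniteField q) where
  open FiniteField F hiding (zero)
  open LinearAlgebra F
  open Polynomials commRing
  open FieldPolynomials F
  open IrreducibleExistence F
  open Algebra.Properties.CommutativeSemiring.Exp P.commutativeSemiring using ()
    renaming (_^_ to _⊗^_)

  onSum : ∀ {m n} (Q : Fin (m ℕ.+ n) → Set) → (∀ i → Q (i ↑ˡ n)) → (∀ j → Q (m ↑ʳ j)) → ∀ k → Q k
  onSum {m} {n} Q left right k = ≡.subst Q (Fin.join-splitAt m n k) (go (splitAt m k))
    where
    go : ∀ s → Q (join m n s)
    go (inj₁ i) = left i
    go (inj₂ j) = right j

  -- The row space of the block matrix `(I | V)`, that is, the graph of the map with matrix `V`. The
  -- identity block returns the coefficients themselves, which gives independence.
  unitSubspace : ∀ {n t} → (Fin t → Vector F n) → Subspace F (t ℕ.+ n) t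
  unitSubspace {n} {t} V = (λ i → δ i ++ V i) , λ c zero-vec j →
    trans (sym (∑-δʳ t c j)) (trans (sym (lincomb-++ˡ c δ V j)) (zero-vec (j ↑ˡ n)))

  singleton : ∀ t r → PartialSpread F (t ℕ.+ r) t 1
  singleton t r = (λ _ → unitSubspace (λ _ _ → 0#)) , λ { zero zero i≢j → contradiction ≡.refl i≢j }

  combination : ∀ {t} → (Fin t → Carrier) → (Fin t → Poly) → Poly
  combination {zero}  c rows = []
  combination {suc t} c rows = constant (c zero) ⊗ rows zero ⊕ combination (λ i → c (suc i)) (λ i → rows (suc i))

  combination-! : ∀ {t} (c : Fin t → Carrier) rows k →
                  combination c rows ! k ≈ ∑ F t (λ i → c i * rows i ! k)
  combination-! {zero}  c rows k = refl
  combination-! {suc t} c rows k = trans (⊕-! (constant (c zero) ⊗ rows zero) _ k) (+-cong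
    (trans (sym (coeff (scale≋⊗ (c zero) (rows zero)) k)) (scale-! (c zero) (rows zero) k))
    (combination-! (λ i → c (suc i)) (λ i → rows (suc i)) k))

  combination-below : ∀ {t} d (c : Fin t → Carrier) rows → (∀ i → DegreeBelow d (rows i)) →
                      DegreeBelow d (combination c rows)
  combination-below {t} d c rows <d k d≤k = trans (combination-! c rows k)
    (∑-0 t λ i → trans (*-congˡ (<d i k d≤k)) (zeroʳ _))

  module Step {N : ℕ} {f : Poly} (irreducible : Irreducible N f) where
    open Extension irreducible
    open PrincipalQuotient polyRing f
    module K = FiniteField extension
    open IntegerCoefficientSolver K.commRing

    -- The factor `Y` is arbitrary because passing to the tail of `c` replaces it by `Y ⊗ X`.
    combination-≈ᶠ : ∀ {t} (c : Fin t → Carrier) rows Y →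
                     (∀ i → rows i ≈ᶠ Y ⊗ X ⊗^ toℕ i) → combination c rows ≈ᶠ Y ⊗ polyOf c
    combination-≈ᶠ {zero}  c rows Y rows≈ = ≈⇒≈ᶠ (P.sym (P.zeroʳ Y))
    combination-≈ᶠ {suc t} c rows Y rows≈ = K.trans
      (K.+-cong (K.*-congˡ {C} (K.trans (rows≈ zero) (K.*-identityʳ Y)))
        (combination-≈ᶠ (λ i → c (suc i)) (λ i → rows (suc i)) (Y ⊗ X)
          (λ i → K.trans (rows≈ (suc i)) (K.sym (K.*-assoc Y X (X ⊗^ toℕ i))))))
      (K.trans (expand C Y X (polyOf (λ i → c (suc i)))) (K.*-congˡ {Y} (≈⇒≈ᶠ (P.sym split))))
      where
      C = constant (c zero)
      expand : ∀ c y x p → c K.* y K.+ y K.* x K.* p K.≈ y K.* (c K.+ x K.* p)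
      expand = solve 4 (λ c y x p → c :* y :+ y :* x :* p := y :* (c :+ x :* p)) K.refl
      split : polyOf c ≋ C ⊕ X ⊗ polyOf (λ i → c (suc i))
      split = P.trans (mk≋ λ { zero → sym (+-identityʳ _) ; (suc i) → refl })
                      (P.+-congˡ {C} (P.sym (X-⊗ (polyOf (λ i → c (suc i))))))

    remainder : Poly → Poly
    remainder p = proj₁ (proj₂ (divMod (isMonic irreducible) p))

    remainder-below : ∀ p → DegreeBelow N (remainder p)
    remainder-below p = proj₂ (proj₂ (proj₂ (divMod (isMonic irreducible) p)))

    remainder-≈ᶠ : ∀ p → remainder p ≈ᶠ p
    remainder-≈ᶠ p with divMod (isMonic irreducible) p
    ... | k , r , p≋ , _ = K.sym (k ,ᶠ P.trans p≋ (P.+-comm (f ⊗ k) r))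

    rows : ∀ {t} → Fin (q ℕ.^ N) → Fin t → Poly
    rows a i = remainder (K.enum a ⊗ X ⊗^ toℕ i)

    -- Multiplication by the `a`-th element of the extension field, restricted to polynomials of
    -- degree below `t` and written in the monomial basis.
    matrix : ∀ {t} → Fin (q ℕ.^ N) → Fin t → Vector F N
    matrix a i k = rows a i ! toℕ k

    -- Equal images mean that the difference of two distinct field elements annihilates the class of
    -- `polyOf c`, so this class is zero. As `t ≤ N`, `polyOf c` is already reduced modulo `f` and
    -- hence zero itself.
    matrix-cancel : ∀ {t} → t ≤ N → ∀ a b → a ≢ b → (c : Fin t → Carrier) →
                    (∀ k → lincomb F c (matrix a) k ≈ lincomb F c (matrix b) k) → ∀ i → c i ≈ 0#
    matrix-cancel {t} t≤N a b a≢b c eq i = trans (sym (polyOf-! c i))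
      (coeff (≈ᶠ⇒≋ c-below (λ _ _ → refl) C≈0) (toℕ i))
      where
      c-below : DegreeBelow N (polyOf c)
      c-below j N≤j = polyOf-DegreeBelow c j (ℕ.≤-trans t≤N N≤j)

      combinations≋ : combination c (rows a) ≋ combination c (rows b)
      combinations≋ = P.trans (P.sym (polyOf-≋ coeffs _ (below a) (λ _ → refl)))
        (polyOf-≋ coeffs _ (below b) λ k → trans (combination-! c (rows a) (toℕ k))
          (trans (eq k) (sym (combination-! c (rows b) (toℕ k)))))
        where
        coeffs : Fin N → Carrier
        coeffs k = combination c (rows a) ! toℕ k
        below : ∀ a → DegreeBelow N (combination c (rows a))
        below a = combination-below N c (rows a) λ i → remainder-below (K.enum a ⊗ X ⊗^ toℕ i)

      products≈ : ∀ a → combination c (rows a) ≈ᶠ K.enum a ⊗ polyOf c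
      products≈ a = combination-≈ᶠ c (rows a) (K.enum a) λ i → remainder-≈ᶠ _

      difference : ∀ x y z → (x K.- y) K.* z K.≈ x K.* z K.- y K.* z
      difference = solve 3 (λ x y z → (x :- y) :* z := x :* z :- y :* z) K.refl

      C≈0 : polyOf c ≈ᶠ []
      C≈0 = FiniteFields.noZeroDivisors extension (K.enum a K.- K.enum b) (polyOf c)
        (λ a-b≈0 → a≢b (K.enum-inj a b (x∙y⁻¹≈ε⇒x≈y _ _ a-b≈0)))
        (K.trans (difference (K.enum a) (K.enum b) (polyOf c))
          (x≈y⇒x∙y⁻¹≈ε (K.trans (K.sym (products≈ a)) (K.trans (≈⇒≈ᶠ combinations≋) (products≈ b)))))
        where open Algebra.Properties.Group K.+-group using (x∙y⁻¹≈ε⇒x≈y; x≈y⇒x∙y⁻¹≈ε)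

    extend : ∀ {t s} → t ≤ N → PartialSpread F N t s → PartialSpread F (t ℕ.+ N) t (q ℕ.^ N ℕ.+ s)
    extend {t} {s} t≤N (S , disjoint) = (λ i → member (splitAt (q ℕ.^ N) i)) , λ i j i≢j →
        trivial (splitAt (q ℕ.^ N) i) (splitAt (q ℕ.^ N) j) λ eq → i≢j
          (≡.trans (≡.sym (Fin.join-splitAt (q ℕ.^ N) s i))
            (≡.trans (≡.cong (join (q ℕ.^ N) s) eq) (Fin.join-splitAt (q ℕ.^ N) s j)))
      where
      O : Fin t → Vector F t
      O _ _ = 0#

      O≈0 : ∀ c → IsZeroVec F (lincomb F c O)
      O≈0 c k = ∑-0 t λ i → zeroʳ (c i)

      basis : Fin s → Fin t → Vector F N
      basis i = proj₁ (S i)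

      member : Fin (q ℕ.^ N) ⊎ Fin s → Subspace F (t ℕ.+ N) t
      member (inj₁ a) = unitSubspace (matrix a)
      member (inj₂ i) = (λ j → O j ++ basis i j) , λ c zero-vec → proj₂ (S i) c λ k →
        trans (sym (lincomb-++ʳ c O (basis i) k)) (zero-vec (t ↑ʳ k))

      graph-coords : ∀ c (V : Fin t → Vector F N) k → lincomb F c (λ i → δ i ++ V i) (k ↑ˡ N) ≈ c k
      graph-coords c V k = trans (lincomb-++ˡ c δ V k) (∑-δʳ t c k)

      old-coords : ∀ c i k → lincomb F c (λ j → O j ++ basis i j) (k ↑ˡ N) ≈ 0#
      old-coords c i k = trans (lincomb-++ˡ c O (basis i) k) (O≈0 c k)

      trivial : ∀ x y → x ≢ y → TrivialIntersection F (member x) (member y)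
      trivial (inj₁ a) (inj₁ b) a≢b c d eq = lincomb-0 (λ i → δ i ++ matrix a i)
        (matrix-cancel t≤N a b (λ a≡b → a≢b (≡.cong inj₁ a≡b)) c λ k →
          trans (sym (lincomb-++ʳ c δ (matrix a) k)) (trans (eq (t ↑ʳ k))
            (trans (lincomb-++ʳ d δ (matrix b) k) (∑-cong t λ i → *-congʳ (sym (c≈d i))))))
        where
        c≈d : ∀ i → c i ≈ d i
        c≈d i = trans (sym (graph-coords c (matrix a) i))
          (trans (eq (i ↑ˡ N)) (graph-coords d (matrix b) i))
      trivial (inj₁ a) (inj₂ i) _ c d eq = lincomb-0 (λ i → δ i ++ matrix a i) λ k →
        trans (sym (graph-coords c (matrix a) k)) (trans (eq (k ↑ˡ N)) (old-coords d i k))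
      trivial (inj₂ i) (inj₁ b) _ c d eq k = trans (eq k) (lincomb-0 (λ i → δ i ++ matrix b i)
        (λ k → trans (sym (graph-coords d (matrix b) k)) (trans (sym (eq (k ↑ˡ N))) (old-coords c i k))) k)
      trivial (inj₂ i) (inj₂ j) i≢j c d eq = onSum _ (old-coords c i) λ k →
        trans (lincomb-++ʳ c O (basis i) k)
          (disjoint i j (λ i≡j → i≢j (≡.cong inj₂ i≡j)) c d (λ k →
            trans (sym (lincomb-++ʳ c O (basis i) k))
              (trans (eq (t ↑ʳ k)) (lincomb-++ʳ d O (basis j) k))) k)

  module _ (t r : ℕ) where
    dimension : ℕ → ℕ
    dimension zero    = t ℕ.+ r
    dimension (suc k) = t ℕ.+ dimension k

    size : ℕ → ℕ
    size zero    = 1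
    size (suc k) = q ℕ.^ dimension k ℕ.+ size k

    t≤dimension : ∀ k → t ≤ dimension k
    t≤dimension zero    = ℕ.m≤m+n t r
    t≤dimension (suc k) = ℕ.m≤m+n t (dimension k)

    partialSpread : 0 < t → ∀ k → PartialSpread F (dimension k) t (size k)
    partialSpread 0<t zero    = singleton t r
    partialSpread 0<t (suc k) = extendTo (dimension k) (t≤dimension k) (partialSpread 0<t k)
      where
      -- Abstracting the dimension to `N` permits matching on its successor form, the one in which
      -- `irreducible-exists` supplies a polynomial.
      extendTo : ∀ N {s} → t ≤ N → PartialSpread F N t s → PartialSpread F (t ℕ.+ N) t (q ℕ.^ N ℕ.+ s)
      extendTo zero     t≤N = contradiction (ℕ.≤-trans 0<t t≤N) λ ()
      extendTo (suc N′) t≤N = Step.extend (proj₂ (irreducible-exists N′)) t≤N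

-- Counting holes

module Counting where
  open Algebra.Properties.Semiring.Sum ℕ.+-*-semiring public
    using (sum; sum-cong-≗; sum-replicate-zero; ∑-distrib-+; ∑-comm; sum-permute; *-distribˡ-sum)
  open SingleTerm ℕ.+-0-commutativeMonoid public

  ind : {A : Set} → Dec A → ℕ
  ind (yes _) = 1
  ind (no  _) = 0

  ind-yes : {A : Set} (A? : Dec A) → A → ind A? ≡ 1
  ind-yes (yes _) a = ≡.refl
  ind-yes (no ¬a) a = contradiction a ¬a

  ind-no : {A : Set} (A? : Dec A) → ¬ A → ind A? ≡ 0
  ind-no (yes a) ¬a = contradiction a ¬a
  ind-no (no _)  ¬a = ≡.refl

  ind-cong : {A B : Set} (A? : Dec A) (B? : Dec B) → (A → B) → (B → A) → ind A? ≡ ind B?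
  ind-cong (yes a) B? to from = ≡.sym (ind-yes B? (to a))
  ind-cong (no ¬a) B? to from = ≡.sym (ind-no B? (λ b → ¬a (from b)))

  ind-× : {A B : Set} (A? : Dec A) (B? : Dec B) → ind (A? ×-dec B?) ≡ ind A? ℕ.* ind B?
  ind-× (yes _) (yes _) = ≡.refl
  ind-× (yes _) (no _)  = ≡.refl
  ind-× (no _)  B?      = ≡.refl

  sum-const : ∀ n c → sum {n} (λ _ → c) ≡ n ℕ.* c
  sum-const zero    c = ≡.refl
  sum-const (suc n) c = ≡.cong (c ℕ.+_) (sum-const n c)

  sum-0 : ∀ {n} (f : Fin n → ℕ) → (∀ i → f i ≡ 0) → sum f ≡ 0
  sum-0 {n} f f≡0 = ≡.trans (sum-cong-≗ f≡0) (sum-replicate-zero n)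

  sum-≥ : ∀ {n} (f : Fin n → ℕ) c → (∀ i → c ≤ f i) → n ℕ.* c ≤ sum f
  sum-≥ {zero}  f c c≤f = z≤n
  sum-≥ {suc n} f c c≤f = ℕ.+-mono-≤ (c≤f zero) (sum-≥ (λ i → f (suc i)) c (λ i → c≤f (suc i)))

  exists-≤-average : ∀ {n} (f : Fin n → ℕ) c → 0 < n → sum f ≡ n ℕ.* c → ∃ λ i → f i ≤ c
  exists-≤-average {suc n} f c _ eq with Fin.any? (λ i → f i ℕ.≤? c)
  ... | yes found = found
  ... | no  none  = contradiction (sum-≥ f (suc c) (λ i → ℕ.≰⇒> (λ le → none (i , le))))
    (ℕ.<⇒≱ (≡.subst (_< suc n ℕ.* suc c) (≡.sym eq) (ℕ.*-monoʳ-< (suc n) (ℕ.n<1+n c))))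

-- Subspaces as decidable sets and their cardinalities

module LinearSets {q : ℕ} (F : FiniteField q) where
  open FiniteField F hiding (zero)
  open FiniteFields F
  open LinearAlgebra F
  open IntegerCoefficientSolver commRing
  open Counting

  -- Decidable predicates replace spans here: kernels and preimages require no choice of basis, and
  -- the hole count sees a subspace only through its cardinality.
  record LinearSet (d : ℕ) : Set₁ where
    field
      In      : Vector F d → Set
      in?     : ∀ v → Dec (In v)
      resp    : ∀ {u v} → (∀ k → u k ≈ v k) → In u → In v
      zero-in : In (λ _ → 0#)
      closed  : ∀ a u v → In u → In v → In (λ k → a * u k + v k)
  open LinearSet public

  record Functional (d : ℕ) : Set where
    field
      apply  : Vector F d → Carrier
      apply-cong : ∀ {u v} → (∀ k → u k ≈ v k) → apply u ≈ apply v
      linear : ∀ a u v → apply (λ k → a * u k + v k) ≈ a * apply u + apply v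
  open Functional public

  apply-0 : ∀ {d} (φ : Functional d) → apply φ (λ _ → 0#) ≈ 0#
  apply-0 φ = trans (apply-cong φ λ k → solve 0 (con ℤ.0ℤ := :- con ℤ.1ℤ :* con ℤ.0ℤ :+ con ℤ.0ℤ) refl)
    (trans (linear φ (- 1#) _ _) (solve 1 (λ x → :- con ℤ.1ℤ :* x :+ x := con ℤ.0ℤ) refl _))

  kernel : ∀ {d} → LinearSet d → Functional d → LinearSet d
  kernel S φ = record
    { In      = λ v → In S v × apply φ v ≈ 0#
    ; in?     = λ v → in? S v ×-dec (apply φ v ≈? 0#)
    ; resp    = λ u≈v (in-u , φu≈0) → resp S u≈v in-u , trans (apply-cong φ (λ k → sym (u≈v k))) φu≈0
    ; zero-in = zero-in S , apply-0 φ
    ; closed  = λ a u v (in-u , φu≈0) (in-v , φv≈0) → closed S a u v in-u in-v ,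
        trans (linear φ a u v) (trans (+-cong (trans (*-congˡ φu≈0) (zeroʳ a)) φv≈0) (+-identityˡ 0#))
    }

  whole : ∀ d → LinearSet d
  whole d = record
    { In = λ _ → ⊤ ; in? = λ _ → yes tt ; resp = λ _ _ → tt ; zero-in = tt ; closed = λ _ _ _ _ _ → tt }

  lincomb-cong : ∀ {n t} (U : Fin t → Vector F n) {c d : Fin t → Carrier} → (∀ i → c i ≈ d i) →
                 ∀ k → lincomb F c U k ≈ lincomb F d U k
  lincomb-cong {t = t} U c≈d k = ∑-cong t λ i → *-congʳ (c≈d i)

  lincomb-linear : ∀ {n t} (U : Fin t → Vector F n) a (c d : Fin t → Carrier) k →
                   lincomb F (λ i → a * c i + d i) U k ≈ a * lincomb F c U k + lincomb F d U k
  lincomb-linear {t = t} U a c d k = trans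
    (∑-cong t λ i → solve 4 (λ a c d u → (a :* c :+ d) :* u := a :* (c :* u) :+ d :* u)
      refl a (c i) (d i) (U i k))
    (trans (∑-+ t _ _) (+-congʳ (∑-* t a _)))

  -- For independent `U` this is the intersection of `S` with the span of `U`, in coordinates
  -- relative to `U`.
  pullback : ∀ {n t} → (Fin t → Vector F n) → LinearSet n → LinearSet t
  pullback U S = record
    { In      = λ c → In S (lincomb F c U)
    ; in?     = λ c → in? S (lincomb F c U)
    ; resp    = λ c≈d → resp S (lincomb-cong U c≈d)
    ; zero-in = resp S (λ k → sym (lincomb-0 U (λ _ → refl) k)) (zero-in S)
    ; closed  = λ a c d in-c in-d → resp S (λ k → sym (lincomb-linear U a c d k))
                  (closed S a _ _ in-c in-d)
    }

  pullbackFunctional : ∀ {n t} → (Fin t → Vector F n) → Functional n → Functional t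
  pullbackFunctional U φ = record
    { apply      = λ c → apply φ (lincomb F c U)
    ; apply-cong = λ c≈d → apply-cong φ (lincomb-cong U c≈d)
    ; linear     = λ a c d → trans (apply-cong φ (lincomb-linear U a c d)) (linear φ a _ _)
    }

  dot : ∀ {n} → Vector F n → Functional n
  dot {n} x = record
    { apply      = λ v → ∑ F n (λ k → x k * v k)
    ; apply-cong = λ u≈v → ∑-cong n λ k → *-congˡ (u≈v k)
    ; linear     = λ a u v → trans
        (∑-cong n λ k → solve 4 (λ x a u v → x :* (a :* u :+ v) := a :* (x :* u) :+ x :* v)
          refl (x k) a (u k) (v k))
        (trans (∑-+ n _ _) (+-congʳ (∑-* n a _)))
    }

  dot-comm : ∀ {n} (x y : Vector F n) → apply (dot x) y ≈ apply (dot y) x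
  dot-comm {n} x y = ∑-cong n λ k → *-comm (x k) (y k)

  dot-δ : ∀ {n} (x : Vector F n) j → apply (dot x) (λ k → δ k j) ≈ x j
  dot-δ {n} x j = ∑-δʳ n x j

  card : ∀ {d} → LinearSet d → ℕ
  card {d} S = sum {q ℕ.^ d} (λ i → ind (in? S (vector i)))

  card-whole : ∀ d → card (whole d) ≡ q ℕ.^ d
  card-whole d = ≡.trans (sum-const (q ℕ.^ d) 1) (ℕ.*-identityʳ _)

  translation : ∀ {d} → Vector F d → Permutation (q ℕ.^ d) (q ℕ.^ d)
  translation {d} u = permutation (shift u) (shift (λ k → - u k))
      (inv u (λ k → - u k) λ k → -‿inverseʳ (u k)) (inv (λ k → - u k) u λ k → -‿inverseˡ (u k))
    where
    shift : Vector F d → Fin (q ℕ.^ d) → Fin (q ℕ.^ d)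
    shift u i = vectorIndex (λ k → u k + vector i k)
    inv : ∀ u v → (∀ k → u k + v k ≈ 0#) → ∀ i → shift u (shift v i) ≡ i
    inv u v u+v≈0 i = vector-injective _ i λ k → trans (vector-vectorIndex _ k)
      (trans (+-congˡ (vector-vectorIndex _ k)) (trans (sym (+-assoc _ _ _))
        (trans (+-congʳ (u+v≈0 k)) (+-identityˡ _))))

  -- The level sets of φ on S are translates of the kernel.
  card-kernel : ∀ {d} (S : LinearSet d) (φ : Functional d) v → In S v → ¬ (apply φ v ≈ 0#) →
                card S ≡ q ℕ.* card (kernel S φ)
  card-kernel {d} S φ v in-v φv≉0 = begin
    sum (λ i → ind (in? S (vector i)))            ≡⟨ sum-cong-≗ byLevel ⟩
    sum (λ i → sum (λ c → ind (level? c i)))      ≡⟨ ∑-comm (λ i c → ind (level? c i)) ⟩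
    sum (λ c → sum (λ i → ind (level? c i)))      ≡⟨ sum-cong-≗ levels-equal ⟩
    sum {q} (λ _ → card (kernel S φ))             ≡⟨ sum-const q _ ⟩
    q ℕ.* card (kernel S φ)                       ∎
    where
    open ≡.≡-Reasoning
    level? : ∀ (c : Fin q) (i : Fin (q ℕ.^ d)) → Dec (In S (vector i) × apply φ (vector i) ≈ enum c)
    level? c i = in? S (vector i) ×-dec (apply φ (vector i) ≈? enum c)

    byLevel : ∀ i → ind (in? S (vector i)) ≡ sum (λ c → ind (level? c i))
    byLevel i = ≡.sym (≡.trans
      (sum-single _ (index (apply φ (vector i))) λ c c≢ → ind-no (level? c i) λ (_ , eq) →
        c≢ (≡.trans (≡.sym (index-enum c)) (index-cong (sym eq))))
      (ind-cong (level? _ i) (in? S (vector i)) proj₁ (λ in-i → in-i , sym (enum-index _))))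

    levels-equal : ∀ c → sum (λ i → ind (level? c i)) ≡ card (kernel S φ)
    levels-equal c = ≡.trans (sum-permute (λ i → ind (level? c i)) (translation u))
      (sum-cong-≗ λ i → ind-cong (level? c (translation u ⟨$⟩ʳ i)) (in? (kernel S φ) (vector i))
        (to i) (from i))
      where
      b : Carrier
      b = enum c * proj₁ (inverse (apply φ v) φv≉0)
      bφv≈c : b * apply φ v ≈ enum c
      bφv≈c = trans (*-assoc _ _ _) (trans (*-congˡ (trans (*-comm _ _) (proj₂ (inverse (apply φ v) φv≉0))))
                (*-identityʳ _))
      u : Vector F d
      u k = b * v k
      shifted : ∀ i k → vector (translation u ⟨$⟩ʳ i) k ≈ b * v k + vector i k
      shifted i = vector-vectorIndex _
      φ-shifted : ∀ i → apply φ (vector (translation u ⟨$⟩ʳ i)) ≈ enum c + apply φ (vector i)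
      φ-shifted i = trans (apply-cong φ (shifted i)) (trans (linear φ b v (vector i)) (+-congʳ bφv≈c))
      open Algebra.Properties.Group +-group using (∙-cancelˡ)
      to : ∀ i → In S (vector (translation u ⟨$⟩ʳ i)) × apply φ (vector (translation u ⟨$⟩ʳ i)) ≈ enum c →
           In (kernel S φ) (vector i)
      to i (in-πi , φπi≈c) =
          resp S (λ k → trans (+-congˡ (shifted i k))
            (solve 3 (λ b v x → :- b :* v :+ (b :* v :+ x) := x) refl b (v k) (vector i k)))
            (closed S (- b) v _ in-v in-πi)
        , ∙-cancelˡ (enum c) _ _ (trans (sym (φ-shifted i)) (trans φπi≈c (sym (+-identityʳ _))))
      from : ∀ i → In (kernel S φ) (vector i) →
             In S (vector (translation u ⟨$⟩ʳ i)) × apply φ (vector (translation u ⟨$⟩ʳ i)) ≈ enum c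
      from i (in-i , φi≈0) =
          resp S (λ k → sym (shifted i k)) (closed S b v _ in-v in-i)
        , trans (φ-shifted i) (trans (+-congˡ φi≈0) (+-identityʳ _))

  -- The exponent `e` stands for the dimension. Only a lower bound `s` is tracked, since a kernel
  -- may or may not lose a dimension.
  HasPowerCard : ∀ {d} → ℕ → LinearSet d → Set
  HasPowerCard s S = ∃ λ e → s ≤ e × card S ≡ q ℕ.^ e

  -- A finite search decides whether `φ` is nonzero somewhere on `S`. If so, the cardinality is
  -- divided by `q`; if not, the kernel is all of `S`.
  kernel-HasPowerCard : ∀ {d s} (S : LinearSet d) (φ : Functional d) →
                        HasPowerCard (suc s) S → HasPowerCard s (kernel S φ)
  kernel-HasPowerCard {d} {s} S φ (suc e , s≤s s≤e , card≡)
    with Fin.any? (λ (i : Fin (q ℕ.^ d)) → in? S (vector i) ×-dec ¬? (apply φ (vector i) ≈? 0#))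
  ... | yes (i , in-i , φi≉0) = e , s≤e ,
        ℕ.*-cancelˡ-≡ _ _ q {{ℕ.>-nonZero (ℕ.<⇒≤ 1<q)}}
          (≡.trans (≡.sym (card-kernel S φ (vector i) in-i φi≉0)) card≡)
  ... | no none = suc e , ℕ.m≤n⇒m≤1+n s≤e , ≡.trans (sum-cong-≗ λ i →
        ind-cong (in? (kernel S φ) (vector i)) (in? S (vector i)) proj₁ λ in-i → in-i , φ≈0 i in-i) card≡
    where
    φ≈0 : ∀ i → In S (vector i) → apply φ (vector i) ≈ 0#
    φ≈0 i in-i with apply φ (vector i) ≈? 0#
    ... | yes eq = eq
    ... | no neq = contradiction (i , in-i , neq) none

-- Holes of a partial spread

module Holes {q : ℕ} (F : FiniteField q) {n t M : ℕ} (spread : PartialSpread F n t M) where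
  open FiniteField F hiding (zero)
  open FiniteFields F
  open LinearAlgebra F
  open LinearSets F
  open Counting

  basis : Fin M → Fin t → Vector F n
  basis i = proj₁ (proj₁ spread i)

  point : Fin M → Fin (q ℕ.^ t) → Vector F n
  point i j = lincomb F (vector j) (basis i)

  Hits : Vector F n → Fin M → Fin (q ℕ.^ t) → Set
  Hits v i j = ∀ k → v k ≈ point i j k

  hits? : ∀ v i j → Dec (Hits v i j)
  hits? v i j = Fin.all? λ k → v k ≈? point i j k

  Covered : Vector F n → Set
  Covered v = ∃₂ λ i j → Hits v i j

  hole? : ∀ v → Dec (¬ Covered v)
  hole? v = ¬? (Fin.any? λ i → Fin.any? λ j → hits? v i j)

  zero? : ∀ (v : Vector F n) → Dec (IsZeroVec F v)
  zero? v = Fin.all? λ k → v k ≈? 0#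

  lincomb-injective : ∀ i c d → (∀ k → lincomb F c (basis i) k ≈ lincomb F d (basis i) k) → ∀ j → c j ≈ d j
  lincomb-injective i c d eq j = x∙y⁻¹≈ε⇒x≈y (c j) (d j) (trans (+-comm _ _) (trans (+-congʳ (sym (-1*x≈-x (d j))))
    (proj₂ (proj₁ spread i) (λ i → - 1# * d i + c i) (λ k → trans (lincomb-linear (basis i) (- 1#) d c k)
      (trans (+-congʳ (-1*x≈-x _)) (trans (+-congˡ (eq k)) (-‿inverseˡ _)))) j)))
    where
    open Algebra.Properties.Group +-group using (x∙y⁻¹≈ε⇒x≈y)
    open Algebra.Properties.Ring ring using (-1*x≈-x)

  hits-uniqueʲ : ∀ {v} i {j j′} → Hits v i j → Hits v i j′ → j ≡ j′
  hits-uniqueʲ i {j} {j′} h h′ = vector-injective j j′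
    (lincomb-injective i _ _ λ k → trans (sym (h k)) (h′ k))

  hits-uniqueⁱ : ∀ {v i i′ j j′} → ¬ IsZeroVec F v → Hits v i j → Hits v i′ j′ → i ≡ i′
  hits-uniqueⁱ {v} {i} {i′} {j} {j′} v≉0 h h′ with i Fin.≟ i′
  ... | yes i≡i′ = i≡i′
  ... | no  i≢i′ = contradiction (λ k → trans (h k)
    (proj₂ spread i i′ i≢i′ (vector j) (vector j′) (λ k → trans (sym (h k)) (h′ k)) k)) v≉0

  hits : Vector F n → ℕ
  hits v = sum λ i → sum λ j → ind (hits? v i j)

  zero-hits : ∀ v → IsZeroVec F v → ∀ i → Hits v i (vectorIndex {t} (λ _ → 0#))
  zero-hits v v≈0 i k = trans (v≈0 k) (sym (lincomb-0 (basis i) (vector-vectorIndex _) k))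

  hits-zero : ∀ v → IsZeroVec F v → hits v ≡ M
  hits-zero v v≈0 = ≡.trans (sum-cong-≗ λ i → ≡.trans
      (sum-single (λ j → ind (hits? v i j)) _
        λ j j≢ → ind-no (hits? v i j) λ h → j≢ (hits-uniqueʲ i h (zero-hits v v≈0 i)))
      (ind-yes (hits? v i _) (zero-hits v v≈0 i)))
    (≡.trans (sum-const M 1) (ℕ.*-identityʳ M))

  hits-covered : ∀ v → ¬ IsZeroVec F v → Covered v → hits v ≡ 1
  hits-covered v v≉0 (i , j , h) = ≡.trans
    (sum-single (λ i → sum λ j → ind (hits? v i j)) i
      λ i′ i′≢i → sum-0 _ λ j′ → ind-no (hits? v i′ j′) λ h′ → i′≢i (hits-uniqueⁱ v≉0 h′ h))
    (≡.trans (sum-single (λ j → ind (hits? v i j)) j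
        λ j′ j′≢j → ind-no (hits? v i j′) λ h′ → j′≢j (hits-uniqueʲ i h′ h))
      (ind-yes (hits? v i j) h))

  hits-hole : ∀ v → ¬ Covered v → hits v ≡ 0
  hits-hole v hole = sum-0 _ λ i → sum-0 _ λ j → ind-no (hits? v i j) λ h → hole (i , j , h)

  module _ (0<M : 0 < M) where
    hole≉0 : ∀ {v} → ¬ Covered v → ¬ IsZeroVec F v
    hole≉0 {v} hole v≈0 = hole (fromℕ< 0<M , _ , zero-hits v v≈0 (fromℕ< 0<M))

    -- Zero is hit once by each member, any other covered vector exactly once, a hole never. Having
    -- at least one member keeps zero from being a hole.
    pointwise : ∀ v → hits v ℕ.+ ind (hole? v) ℕ.+ ind (zero? v) ≡ 1 ℕ.+ M ℕ.* ind (zero? v)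
    pointwise v with zero? v | Fin.any? (λ i → Fin.any? λ j → hits? v i j)
    ... | yes v≈0 | yes c rewrite hits-zero v v≈0 | ℕ.*-identityʳ M | ℕ.+-identityʳ M = ℕ.+-comm M 1
    ... | yes v≈0 | no ¬c = contradiction v≈0 (hole≉0 ¬c)
    ... | no v≉0  | yes c rewrite hits-covered v v≉0 c | ℕ.*-zeroʳ M = ≡.refl
    ... | no v≉0  | no ¬c rewrite hits-hole v ¬c | ℕ.*-zeroʳ M = ≡.refl

  holes : LinearSet n → ℕ
  holes S = sum {q ℕ.^ n} λ x → ind (in? S (vector x)) ℕ.* ind (hole? (vector x))

  count-zero : ∀ S → sum {q ℕ.^ n} (λ x → ind (in? S (vector x)) ℕ.* ind (zero? (vector x))) ≡ 1
  count-zero S = ≡.trans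
    (sum-single (λ x → ind (in? S (vector x)) ℕ.* ind (zero? (vector x))) o
      λ x x≢o → ≡.trans (≡.cong (ind (in? S (vector x)) ℕ.*_)
      (ind-no (zero? (vector x)) λ x≈0 → x≢o (vector-injective x o λ k →
        trans (x≈0 k) (sym (o≈0 k))))) (ℕ.*-zeroʳ (ind (in? S (vector x)))))
    (≡.cong₂ ℕ._*_ (ind-yes (in? S (vector o)) (resp S (λ k → sym (o≈0 k)) (zero-in S)))
                   (ind-yes (zero? (vector o)) o≈0))
    where
    o : Fin (q ℕ.^ n)
    o = vectorIndex {n} (λ _ → 0#)
    o≈0 : IsZeroVec F (vector o)
    o≈0 = vector-vectorIndex {n} (λ _ → 0#)

  -- After exchanging the sums, each pair of a member and a coefficient vector hits exactly one
  -- vector, and what remains is whether that vector lies in `S`.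
  count-hits : ∀ S → sum {q ℕ.^ n} (λ x → ind (in? S (vector x)) ℕ.* hits (vector x))
                     ≡ sum (λ i → card (pullback (basis i) S))
  count-hits S = begin
    sum (λ x → S[ x ] ℕ.* hits (vector x))
      ≡⟨ sum-cong-≗ (λ x → ≡.trans (*-distribˡ-sum S[ x ] (λ i → sum λ j → ind (hits? (vector x) i j)))
           (sum-cong-≗ λ i → *-distribˡ-sum S[ x ] (λ j → ind (hits? (vector x) i j)))) ⟩
    sum (λ x → sum λ i → sum λ j → S[ x ] ℕ.* ind (hits? (vector x) i j))
      ≡⟨ ∑-comm (λ x i → sum λ j → S[ x ] ℕ.* ind (hits? (vector x) i j)) ⟩
    sum (λ i → sum λ x → sum λ j → S[ x ] ℕ.* ind (hits? (vector x) i j))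
      ≡⟨ sum-cong-≗ (λ i → ∑-comm (λ x j → S[ x ] ℕ.* ind (hits? (vector x) i j))) ⟩
    sum (λ i → sum λ j → sum λ x → S[ x ] ℕ.* ind (hits? (vector x) i j))
      ≡⟨ sum-cong-≗ (λ i → sum-cong-≗ (unique i)) ⟩
    sum (λ i → card (pullback (basis i) S)) ∎
    where
    open ≡.≡-Reasoning
    S[_] : Fin (q ℕ.^ n) → ℕ
    S[ x ] = ind (in? S (vector x))
    unique : ∀ i j → sum (λ x → S[ x ] ℕ.* ind (hits? (vector x) i j))
                     ≡ ind (in? (pullback (basis i) S) (vector j))
    unique i j = ≡.trans (sum-single (λ x → S[ x ] ℕ.* ind (hits? (vector x) i j)) y
      λ x x≢y → ≡.trans (≡.cong (S[ x ] ℕ.*_)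
        (ind-no (hits? (vector x) i j) λ h → x≢y (vector-injective x y λ k → trans (h k) (sym (y≈ k)))))
        (ℕ.*-zeroʳ S[ x ]))
      (≡.trans (≡.cong (S[ y ] ℕ.*_) (ind-yes (hits? (vector y) i j) y≈))
        (≡.trans (ℕ.*-identityʳ S[ y ])
          (ind-cong (in? S (vector y)) (in? S (point i j)) (resp S y≈) (resp S λ k → sym (y≈ k)))))
      where
      y : Fin (q ℕ.^ n)
      y = vectorIndex (point i j)
      y≈ : ∀ k → vector y k ≈ point i j k
      y≈ = vector-vectorIndex (point i j)

  -- The sections contain zero `M` times, `card S` contains it once; the summands `1` and `M`
  -- balance this without subtraction.
  hole-count : 0 < M → ∀ S → sum (λ i → card (pullback (basis i) S)) ℕ.+ holes S ℕ.+ 1 ≡ card S ℕ.+ M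
  hole-count 0<M S = begin
    sum (λ i → card (pullback (basis i) S)) ℕ.+ holes S ℕ.+ 1
      ≡⟨ ≡.cong₂ ℕ._+_ (≡.cong (ℕ._+ holes S) (≡.sym (count-hits S))) (≡.sym (count-zero S)) ⟩
    sum (λ x → S[ x ] ℕ.* hits (vector x)) ℕ.+ holes S ℕ.+ sum (λ x → S[ x ] ℕ.* zero[ x ])
      ≡⟨ ≡.cong (ℕ._+ sum (λ x → S[ x ] ℕ.* zero[ x ]))
           (∑-distrib-+ (λ x → S[ x ] ℕ.* hits (vector x)) (λ x → S[ x ] ℕ.* hole[ x ])) ⟨
    sum (λ x → S[ x ] ℕ.* hits (vector x) ℕ.+ S[ x ] ℕ.* hole[ x ]) ℕ.+ sum (λ x → S[ x ] ℕ.* zero[ x ])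
      ≡⟨ ∑-distrib-+ (λ x → S[ x ] ℕ.* hits (vector x) ℕ.+ S[ x ] ℕ.* hole[ x ])
           (λ x → S[ x ] ℕ.* zero[ x ]) ⟨
    sum (λ x → S[ x ] ℕ.* hits (vector x) ℕ.+ S[ x ] ℕ.* hole[ x ] ℕ.+ S[ x ] ℕ.* zero[ x ])
      ≡⟨ sum-cong-≗ regroup ⟩
    sum (λ x → S[ x ] ℕ.+ M ℕ.* (S[ x ] ℕ.* zero[ x ]))
      ≡⟨ ∑-distrib-+ S[_] (λ x → M ℕ.* (S[ x ] ℕ.* zero[ x ])) ⟩
    card S ℕ.+ sum (λ x → M ℕ.* (S[ x ] ℕ.* zero[ x ]))
      ≡⟨ ≡.cong (card S ℕ.+_) (*-distribˡ-sum M (λ x → S[ x ] ℕ.* zero[ x ])) ⟨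
    card S ℕ.+ M ℕ.* sum (λ x → S[ x ] ℕ.* zero[ x ])
      ≡⟨ ≡.cong (λ z → card S ℕ.+ M ℕ.* z) (count-zero S) ⟩
    card S ℕ.+ M ℕ.* 1
      ≡⟨ ≡.cong (card S ℕ.+_) (ℕ.*-identityʳ M) ⟩
    card S ℕ.+ M ∎
    where
    open ≡.≡-Reasoning
    S[_] hole[_] zero[_] : Fin (q ℕ.^ n) → ℕ
    S[ x ] = ind (in? S (vector x))
    hole[ x ] = ind (hole? (vector x))
    zero[ x ] = ind (zero? (vector x))
    regroup : ∀ x → S[ x ] ℕ.* hits (vector x) ℕ.+ S[ x ] ℕ.* hole[ x ] ℕ.+ S[ x ] ℕ.* zero[ x ]
                    ≡ S[ x ] ℕ.+ M ℕ.* (S[ x ] ℕ.* zero[ x ])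
    regroup x = begin
      S[ x ] ℕ.* hits (vector x) ℕ.+ S[ x ] ℕ.* hole[ x ] ℕ.+ S[ x ] ℕ.* zero[ x ]
        ≡⟨ solve 4 (λ s a b c → s :* a :+ s :* b :+ s :* c := s :* (a :+ b :+ c)) ≡.refl
             S[ x ] (hits (vector x)) hole[ x ] zero[ x ] ⟩
      S[ x ] ℕ.* (hits (vector x) ℕ.+ hole[ x ] ℕ.+ zero[ x ])
        ≡⟨ ≡.cong (S[ x ] ℕ.*_) (pointwise 0<M (vector x)) ⟩
      S[ x ] ℕ.* (1 ℕ.+ M ℕ.* zero[ x ])
        ≡⟨ solve 3 (λ s m z → s :* (con 1 :+ m :* z) := s :+ m :* (s :* z)) ≡.refl S[ x ] M zero[ x ] ⟩
      S[ x ] ℕ.+ M ℕ.* (S[ x ] ℕ.* zero[ x ]) ∎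
      where open +-*-Solver

  -- By symmetry of the dot product these `x` form the kernel of `dot v`, which is nonzero at the
  -- unit vector of a nonzero coordinate of `v`.
  annihilators : ∀ v → ¬ IsZeroVec F v →
                 q ℕ.* sum {q ℕ.^ n} (λ x → ind (apply (dot (vector x)) v ≈? 0#)) ≡ q ℕ.^ n
  annihilators v v≉0 with Fin.any? (λ k → ¬? (v k ≈? 0#))
  ... | no none = contradiction (λ k → decided k (v k ≈? 0#)) v≉0
    where
    decided : ∀ k → Dec (v k ≈ 0#) → v k ≈ 0#
    decided k (yes eq) = eq
    decided k (no neq) = contradiction (k , neq) none
  ... | yes (k , vk≉0) = ≡.trans (≡.cong (q ℕ.*_) (sum-cong-≗ λ x →
        ind-cong (apply (dot (vector x)) v ≈? 0#) (in? (kernel (whole n) (dot v)) (vector x))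
          (λ eq → tt , trans (dot-comm v (vector x)) eq) (λ (_ , eq) → trans (dot-comm (vector x) v) eq)))
      (≡.trans (≡.sym (card-kernel (whole n) (dot v) (λ j → δ j k) tt
        λ eq → vk≉0 (trans (sym (dot-δ v k)) eq))) (card-whole n))

  -- Holes are nonzero, so each lies in the kernel of exactly one functional out of `q`. The zero
  -- functional is included in the sum, which makes the average exact.
  average : 0 < M → ∀ S → sum {q ℕ.^ n} (λ x → q ℕ.* holes (kernel S (dot (vector x)))) ≡ q ℕ.^ n ℕ.* holes S
  average 0<M S = begin
    sum (λ x → q ℕ.* holes (kernel S (dot (vector x))))
      ≡⟨ *-distribˡ-sum q (λ x → holes (kernel S (dot (vector x)))) ⟨
    q ℕ.* sum (λ x → holes (kernel S (dot (vector x))))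
      ≡⟨ ≡.cong (q ℕ.*_) (∑-comm (λ x y → ind (in? (kernel S (dot (vector x))) (vector y)) ℕ.* hole[ y ])) ⟩
    q ℕ.* sum (λ y → sum λ x → ind (in? (kernel S (dot (vector x))) (vector y)) ℕ.* hole[ y ])
      ≡⟨ *-distribˡ-sum q (λ y → sum λ x → ind (in? (kernel S (dot (vector x))) (vector y)) ℕ.* hole[ y ]) ⟩
    sum (λ y → q ℕ.* sum λ x → ind (in? (kernel S (dot (vector x))) (vector y)) ℕ.* hole[ y ])
      ≡⟨ sum-cong-≗ each ⟩
    sum (λ y → q ℕ.^ n ℕ.* (S[ y ] ℕ.* hole[ y ]))
      ≡⟨ *-distribˡ-sum (q ℕ.^ n) (λ y → S[ y ] ℕ.* hole[ y ]) ⟨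
    q ℕ.^ n ℕ.* holes S ∎
    where
    open ≡.≡-Reasoning
    open +-*-Solver
    S[_] hole[_] : Fin (q ℕ.^ n) → ℕ
    S[ x ] = ind (in? S (vector x))
    hole[ x ] = ind (hole? (vector x))
    orth : Fin (q ℕ.^ n) → Fin (q ℕ.^ n) → ℕ
    orth x y = ind (apply (dot (vector {n} x)) (vector y) ≈? 0#)
    each : ∀ y → q ℕ.* sum (λ x → ind (in? (kernel S (dot (vector x))) (vector y)) ℕ.* hole[ y ])
                 ≡ q ℕ.^ n ℕ.* (S[ y ] ℕ.* hole[ y ])
    each y with hole? (vector y)
    ... | no _ = ≡.trans
      (≡.cong (q ℕ.*_) (sum-0 (λ x → ind (in? (kernel S (dot (vector x))) (vector y)) ℕ.* 0)
        λ x → ℕ.*-zeroʳ (ind (in? (kernel S (dot (vector x))) (vector y)))))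
      (≡.trans (ℕ.*-zeroʳ q) (≡.sym (≡.trans (≡.cong (q ℕ.^ n ℕ.*_) (ℕ.*-zeroʳ S[ y ])) (ℕ.*-zeroʳ (q ℕ.^ n)))))
    ... | yes hole = begin
      q ℕ.* sum (λ x → ind (in? (kernel S (dot (vector x))) (vector y)) ℕ.* 1)
        ≡⟨ ≡.cong (q ℕ.*_) (sum-cong-≗ λ x → ≡.trans
             (ℕ.*-identityʳ (ind (in? (kernel S (dot (vector x))) (vector y))))
             (ind-× (in? S (vector y)) (apply (dot (vector {n} x)) (vector y) ≈? 0#))) ⟩
      q ℕ.* sum (λ x → S[ y ] ℕ.* orth x y)
        ≡⟨ ≡.cong (q ℕ.*_) (*-distribˡ-sum S[ y ] (λ x → orth x y)) ⟨
      q ℕ.* (S[ y ] ℕ.* sum (λ x → orth x y))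
        ≡⟨ solve 3 (λ q s x → q :* (s :* x) := s :* (q :* x)) ≡.refl q S[ y ] (sum (λ x → orth x y)) ⟩
      S[ y ] ℕ.* (q ℕ.* sum (λ x → orth x y))
        ≡⟨ ≡.cong (S[ y ] ℕ.*_) (annihilators (vector y) (hole≉0 0<M hole)) ⟩
      S[ y ] ℕ.* q ℕ.^ n
        ≡⟨ ℕ.*-comm S[ y ] _ ⟩
      q ℕ.^ n ℕ.* S[ y ]
        ≡⟨ ≡.cong (q ℕ.^ n ℕ.*_) (ℕ.*-identityʳ S[ y ]) ⟨
      q ℕ.^ n ℕ.* (S[ y ] ℕ.* 1) ∎

  fewer-holes : 0 < M → ∀ S → ∃ λ (φ : Functional n) → q ℕ.* holes (kernel S φ) ≤ holes S
  fewer-holes 0<M S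
    with exists-≤-average (λ x → q ℕ.* holes (kernel S (dot (vector x)))) (holes S)
           (ℕ.m^n>0 q {{ℕ.>-nonZero (ℕ.<⇒≤ 1<q)}} n) (average 0<M S)
  ... | x , le = dot (vector x) , le

-- The descent

module HoleArithmetic where
  open import Data.Nat.Divisibility using (_∣_; divides; ∣-trans; ∣m+n∣m⇒∣n; ∣m∣n⇒∣m+n; m∣m*n; n∣m*n)
  open +-*-Solver
  open Counting

  sum-∣ : ∀ {M} d (f : Fin M → ℕ) → (∀ i → d ∣ f i) → d ∣ sum f
  sum-∣ {zero}  d f d∣f = ℕ∣._∣0 d
  sum-∣ {suc M} d f d∣f = ∣m∣n⇒∣m+n (d∣f zero) (sum-∣ d (λ i → f (suc i)) (λ i → d∣f (suc i)))

  sum-≡1 : ∀ {M} p (f : Fin M → ℕ) → (∀ i → ∃ λ θ → f i ≡ 1 ℕ.+ p ℕ.* θ) → ∃ λ T → sum f ≡ M ℕ.+ p ℕ.* T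
  sum-≡1 {zero}  p f f≡1 = 0 , ≡.sym (ℕ.*-zeroʳ p)
  sum-≡1 {suc M} p f f≡1 with f≡1 zero | sum-≡1 p (λ i → f (suc i)) (λ i → f≡1 (suc i))
  ... | θ , eq | T , eq′ = θ ℕ.+ T , ≡.trans (≡.cong₂ ℕ._+_ eq eq′)
    (solve 4 (λ p θ M T → con 1 :+ p :* θ :+ (M :+ p :* T) := con 1 :+ M :+ p :* (θ :+ T))
        ≡.refl p θ M T)

  power≡1 : ∀ q → 0 < q → ∀ e → ∃ λ θ → q ℕ.^ e ≡ 1 ℕ.+ ℕ.pred q ℕ.* θ
  power≡1 (suc p) _   zero    = 0 , ≡.cong suc (≡.sym (ℕ.*-zeroʳ p))
  power≡1 (suc p) 0<q (suc e) with power≡1 (suc p) 0<q e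
  ... | θ , eq = 1 ℕ.+ suc p ℕ.* θ , ≡.trans (≡.cong (suc p ℕ.*_) eq)
    (solve 2 (λ p θ → (con 1 :+ p) :* (con 1 :+ p :* θ) := con 1 :+ p :* (con 1 :+ (con 1 :+ p) :* θ))
      ≡.refl p θ)

  power-∣ : ∀ b {s e} → s ≤ e → b ℕ.^ s ∣ b ℕ.^ e
  power-∣ b {s} {e} s≤e = divides (b ℕ.^ (e ℕ.∸ s))
    (≡.trans (≡.cong (b ℕ.^_) (≡.sym (ℕ.m∸n+n≡m s≤e))) (ℕ.^-distribˡ-+-* b (e ℕ.∸ s) s))

  -- Subtracting `Y Q` gives `w = (Z - Y) Q + 1`, where `w ≥ 0` only forces `Z - Y ≥ -1`. Adding one
  -- `Q` turns the coefficient into the natural number `Z + 1 - Y`.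
  leading-part : ∀ Y Z w Q → 0 < Q → Y ℕ.* Q ℕ.+ w ≡ Z ℕ.* Q ℕ.+ 1 → ∃ λ A → w ℕ.+ Q ≡ A ℕ.* Q ℕ.+ 1
  leading-part Y Z w Q 0<Q eq with Y ℕ.≤? suc Z
  ... | yes Y≤ = A , ℕ.+-cancelˡ-≡ (Y ℕ.* Q) _ _ (begin
      Y ℕ.* Q ℕ.+ (w ℕ.+ Q)          ≡⟨ ℕ.+-assoc (Y ℕ.* Q) w Q ⟨
      Y ℕ.* Q ℕ.+ w ℕ.+ Q            ≡⟨ ≡.cong (ℕ._+ Q) eq ⟩
      Z ℕ.* Q ℕ.+ 1 ℕ.+ Q
        ≡⟨ solve 2 (λ Z Q → Z :* Q :+ con 1 :+ Q := (con 1 :+ Z) :* Q :+ con 1) ≡.refl Z Q ⟩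
      suc Z ℕ.* Q ℕ.+ 1              ≡⟨ ≡.cong (λ z → z ℕ.* Q ℕ.+ 1) (ℕ.m+[n∸m]≡n Y≤) ⟨
      (Y ℕ.+ A) ℕ.* Q ℕ.+ 1
        ≡⟨ solve 3 (λ Y A Q → (Y :+ A) :* Q :+ con 1 := Y :* Q :+ (A :* Q :+ con 1)) ≡.refl Y A Q ⟩
      Y ℕ.* Q ℕ.+ (A ℕ.* Q ℕ.+ 1)    ∎)
    where
    open ≡.≡-Reasoning
    A = suc Z ℕ.∸ Y
  ... | no Y≰ = contradiction (begin-strict
      Z ℕ.* Q ℕ.+ 1            <⟨ ℕ.+-monoʳ-< (Z ℕ.* Q) {1} (ℕ.+-mono-≤ 0<Q 0<Q) ⟩
      Z ℕ.* Q ℕ.+ (Q ℕ.+ Q)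
        ≡⟨ solve 2 (λ Z Q → Z :* Q :+ (Q :+ Q) := (con 2 :+ Z) :* Q) ≡.refl Z Q ⟩
      (2 ℕ.+ Z) ℕ.* Q          ≤⟨ ℕ.*-monoˡ-≤ Q (ℕ.≰⇒> Y≰) ⟩
      Y ℕ.* Q                  ≤⟨ ℕ.m≤m+n (Y ℕ.* Q) w ⟩
      Y ℕ.* Q ℕ.+ w            ≡⟨ eq ⟩
      Z ℕ.* Q ℕ.+ 1            ∎) (ℕ.<-irrefl ≡.refl)
    where open ℕ.≤-Reasoning

  -- Since `1 + p θ` is 1 modulo `p`, the equation reduces to `w ≡ A` modulo `p`.
  leading-∣ : ∀ p A θ w → p ∣ w → w ℕ.+ (1 ℕ.+ p ℕ.* θ) ≡ A ℕ.* (1 ℕ.+ p ℕ.* θ) ℕ.+ 1 → p ∣ A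
  leading-∣ p A θ w p∣w eq = ∣m+n∣m⇒∣n (≡.subst (p ∣_) eq′ (∣m∣n⇒∣m+n p∣w (m∣m*n θ)))
                                       (∣-trans (m∣m*n θ) (n∣m*n A))
    where
    eq′ : w ℕ.+ p ℕ.* θ ≡ A ℕ.* (p ℕ.* θ) ℕ.+ A
    eq′ = ℕ.suc-injective (≡.trans (solve 2 (λ w x → con 1 :+ (w :+ x) := w :+ (con 1 :+ x))
        ≡.refl w (p ℕ.* θ))
      (≡.trans eq (solve 2 (λ A x → A :* (con 1 :+ x) :+ con 1 := con 1 :+ (A :* x :+ A))
          ≡.refl A (p ℕ.* θ))))

  -- Here `a` is the total of the sections, `b` the cardinality of the subspace and `2 + L` the
  -- number of members. Of the 2, one unit cancels against the 1 on the left and the other becomes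
  -- the residue of `w` modulo `Q`.
  remainder-form : ∀ {p Q w a b L} → 0 < Q → (∃ λ θ → Q ≡ 1 ℕ.+ p ℕ.* θ) → p ∣ w →
                   Q ∣ a → Q ∣ b → Q ∣ L → a ℕ.+ w ℕ.+ 1 ≡ b ℕ.+ (2 ℕ.+ L) →
                   ∃ λ c → w ℕ.+ Q ≡ c ℕ.* p ℕ.* Q ℕ.+ 1
  remainder-form {p} {Q} {w} 0<Q (θ , Q≡) p∣w (divides Y ≡.refl) (divides y ≡.refl) (divides l ≡.refl) eq
    with leading-part Y (y ℕ.+ l) w Q 0<Q (ℕ.+-cancelʳ-≡ 1 _ _ (≡.trans eq
      (solve 3 (λ y l Q → y :* Q :+ (con 2 :+ l :* Q) := (y :+ l) :* Q :+ con 1 :+ con 1)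
          ≡.refl y l Q)))
  ... | A , eq′ with leading-∣ p A θ w p∣w (≡.subst (λ Q → w ℕ.+ Q ≡ A ℕ.* Q ℕ.+ 1) Q≡ eq′)
  ... | divides c ≡.refl = c , eq′

  -- Multiplying the second equation by `q` and comparing gives `c′ p q Q + q ≤ c p q Q + 1`. As `q`
  -- exceeds 1, this excludes `c ≤ c′`.
  leading-decreases : ∀ p q Q c c′ w w′ → 1 < q → q ℕ.* w′ ≤ w →
    w ℕ.+ q ℕ.* Q ≡ c ℕ.* p ℕ.* (q ℕ.* Q) ℕ.+ 1 → w′ ℕ.+ Q ≡ c′ ℕ.* p ℕ.* Q ℕ.+ 1 → c′ < c
  leading-decreases p q Q c c′ w w′ 1<q le eq eq′ with c ℕ.≤? c′
  ... | no  c≰c′ = ℕ.≰⇒> c≰c′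
  ... | yes c≤c′ = contradiction (ℕ.+-cancelˡ-≤ (c′ ℕ.* p ℕ.* (q ℕ.* Q)) q 1 (begin
      c′ ℕ.* p ℕ.* (q ℕ.* Q) ℕ.+ q
        ≡⟨ solve 4 (λ c p q Q → c :* p :* (q :* Q) :+ q := q :* (c :* p :* Q :+ con 1))
            ≡.refl c′ p q Q ⟩
      q ℕ.* (c′ ℕ.* p ℕ.* Q ℕ.+ 1)  ≡⟨ ≡.cong (q ℕ.*_) eq′ ⟨
      q ℕ.* (w′ ℕ.+ Q)              ≡⟨ ℕ.*-distribˡ-+ q w′ Q ⟩
      q ℕ.* w′ ℕ.+ q ℕ.* Q          ≤⟨ ℕ.+-monoˡ-≤ (q ℕ.* Q) le ⟩
      w ℕ.+ q ℕ.* Q                 ≡⟨ eq ⟩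
      c ℕ.* p ℕ.* (q ℕ.* Q) ℕ.+ 1   ≤⟨ ℕ.+-monoˡ-≤ 1 (ℕ.*-monoˡ-≤ (q ℕ.* Q) (ℕ.*-monoˡ-≤ p c≤c′)) ⟩
      c′ ℕ.* p ℕ.* (q ℕ.* Q) ℕ.+ 1  ∎)) (ℕ.<⇒≱ 1<q)
    where open ℕ.≤-Reasoning

module Descent {q : ℕ} (F : FiniteField q) {n t L : ℕ} (spread : PartialSpread F n t (2 ℕ.+ L)) where
  open FiniteFields F using (1<q)
  open LinearSets F
  open Holes F spread
  open Counting
  open HoleArithmetic
  open import Data.Nat.Divisibility using (_∣_; divides; ∣-trans; ∣m+n∣m⇒∣n; ∣m∣n⇒∣m+n; m∣m*n; n∣m*n)
  open +-*-Solver

  private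
    p : ℕ
    p = ℕ.pred q

    0<q : 0 < q
    0<q = ℕ.<⇒≤ 1<q

    instance
      q≢0 : NonZero q
      q≢0 = ℕ.>-nonZero 0<q

  record MeetsInPowers (s : ℕ) (S : LinearSet n) : Set where
    field
      ambient  : HasPowerCard s S
      sections : ∀ i → HasPowerCard s (pullback (basis i) S)
  open MeetsInPowers

  kernel-MeetsInPowers : ∀ {s} S φ → MeetsInPowers (suc s) S → MeetsInPowers s (kernel S φ)
  kernel-MeetsInPowers S φ meets = record
    { ambient  = kernel-HasPowerCard S φ (ambient meets)
    ; sections = λ i → kernel-HasPowerCard (pullback (basis i) S) (pullbackFunctional (basis i) φ) (sections meets i)
    }

  whole-MeetsInPowers : t ≤ n → MeetsInPowers t (whole n)
  whole-MeetsInPowers t≤n = record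
    { ambient  = n , t≤n , card-whole n
    ; sections = λ i → t , ℕ.≤-refl , card-whole t
    }

  card-∣ : ∀ {d s} (S : LinearSet d) → HasPowerCard s S → q ℕ.^ s ∣ card S
  card-∣ {s = s} S (e , s≤e , card≡) = ≡.subst (q ℕ.^ s ∣_) (≡.sym card≡) (power-∣ q s≤e)

  card≡1 : ∀ {d s} (S : LinearSet d) → HasPowerCard s S → ∃ λ θ → card S ≡ 1 ℕ.+ p ℕ.* θ
  card≡1 S (e , _ , card≡) with power≡1 q 0<q e
  ... | θ , eq = θ , ≡.trans card≡ eq

  -- All cardinalities are 1 modulo `p`, so `hole-count` becomes `M + w + 1 ≡ 1 + M` for `M = 2 + L`
  -- members and `w` holes.
  p∣holes : ∀ {s} S → MeetsInPowers s S → p ∣ holes S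
  p∣holes S meets with card≡1 S (ambient meets)
      | sum-≡1 p (λ i → card (pullback (basis i) S)) (λ i → card≡1 (pullback (basis i) S) (sections meets i))
  ... | θ , card≡ | T , sum≡ = ∣m+n∣m⇒∣n (≡.subst (p ∣_) (≡.sym pT+w≡pθ) (m∣m*n θ)) (m∣m*n T)
    where
    pT+w≡pθ : p ℕ.* T ℕ.+ holes S ≡ p ℕ.* θ
    pT+w≡pθ = ℕ.+-cancelˡ-≡ (3 ℕ.+ L) _ _ (begin
      (3 ℕ.+ L) ℕ.+ (p ℕ.* T ℕ.+ holes S)
        ≡⟨ solve 3 (λ L x w → con 3 :+ L :+ (x :+ w) := con 2 :+ L :+ x :+ w :+ con 1)
            ≡.refl L (p ℕ.* T) (holes S) ⟩
      (2 ℕ.+ L) ℕ.+ p ℕ.* T ℕ.+ holes S ℕ.+ 1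
        ≡⟨ ≡.cong (λ x → x ℕ.+ holes S ℕ.+ 1) sum≡ ⟨
      sum (λ i → card (pullback (basis i) S)) ℕ.+ holes S ℕ.+ 1  ≡⟨ hole-count (s≤s z≤n) S ⟩
      card S ℕ.+ (2 ℕ.+ L)                   ≡⟨ ≡.cong (ℕ._+ (2 ℕ.+ L)) card≡ ⟩
      1 ℕ.+ p ℕ.* θ ℕ.+ (2 ℕ.+ L)
        ≡⟨ solve 2 (λ L x → con 1 :+ x :+ (con 2 :+ L) := con 3 :+ L :+ x) ≡.refl L (p ℕ.* θ) ⟩
      (3 ℕ.+ L) ℕ.+ p ℕ.* θ                  ∎)
      where open ≡.≡-Reasoning

  holes-form : ∀ s S → MeetsInPowers s S → q ℕ.^ s ∣ L →
               ∃ λ c → holes S ℕ.+ q ℕ.^ s ≡ c ℕ.* p ℕ.* q ℕ.^ s ℕ.+ 1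
  holes-form s S meets Q∣L = remainder-form (ℕ.m^n>0 q s) (power≡1 q 0<q s) (p∣holes S meets)
    (sum-∣ (q ℕ.^ s) (λ i → card (pullback (basis i) S)) (λ i → card-∣ (pullback (basis i) S) (sections meets i)))
    (card-∣ S (ambient meets)) Q∣L (hole-count (s≤s z≤n) S)

  -- The invariant `c < s` survives a hyperplane section, as `s` drops by one and `c` by at least
  -- one; it is absurd at `s = 0`, where the descent ends.
  descend : ∀ s c S → MeetsInPowers s S → q ℕ.^ s ∣ L →
            holes S ℕ.+ q ℕ.^ s ≡ c ℕ.* p ℕ.* q ℕ.^ s ℕ.+ 1 → ¬ (c < s)
  descend (suc s) c S meets Q∣L eq (s≤s c≤s) = restricted (fewer-holes (s≤s z≤n) S)
    where
    Q′∣L : q ℕ.^ s ∣ L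
    Q′∣L = ∣-trans (n∣m*n q) Q∣L
    continue : ∀ φ → q ℕ.* holes (kernel S φ) ≤ holes S →
               ¬ (∃ λ c′ → holes (kernel S φ) ℕ.+ q ℕ.^ s ≡ c′ ℕ.* p ℕ.* q ℕ.^ s ℕ.+ 1)
    continue φ le (c′ , eq′) = descend s c′ (kernel S φ) (kernel-MeetsInPowers S φ meets) Q′∣L eq′
      (ℕ.<-≤-trans (leading-decreases p q (q ℕ.^ s) c c′ (holes S) (holes (kernel S φ)) 1<q le eq eq′) c≤s)
    restricted : ¬ (∃ λ φ → q ℕ.* holes (kernel S φ) ≤ holes S)
    restricted (φ , le) = continue φ le (holes-form s (kernel S φ) (kernel-MeetsInPowers S φ meets) Q′∣L)

  -- The equation for `L` is the geometric sum freed of subtraction and division. The coefficient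
  -- `c` is returned with its defining equation, to be identified with the quotient
  -- `(q^r - 1) / (q - 1)` of the hypothesis.
  impossible : ∀ r → t ≤ n → q ℕ.^ t ∣ L → L ℕ.* q ℕ.^ t ℕ.+ q ℕ.^ (t ℕ.+ r) ≡ q ℕ.^ n ℕ.+ L →
               ∃ λ c → q ℕ.^ r ≡ 1 ℕ.+ c ℕ.* p × ¬ (c < t)
  impossible r t≤n Q∣L L≡ = conclude (holes-form t (whole n) (whole-MeetsInPowers t≤n) Q∣L)
    where
    open ≡.≡-Reasoning
    Q w : ℕ
    Q = q ℕ.^ t
    w = holes (whole n)
    sum≡ : sum (λ i → card (pullback (basis i) (whole n))) ≡ (2 ℕ.+ L) ℕ.* Q
    sum≡ = ≡.trans (sum-cong-≗ {2 ℕ.+ L} λ i → card-whole t) (sum-const (2 ℕ.+ L) Q)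
    -- Thus `w = (q^r - 2) Q + 1`, and comparison with the general form of `w` yields
    -- `c p = q^r - 1`.
    initial : 2 ℕ.* Q ℕ.+ w ≡ Q ℕ.* q ℕ.^ r ℕ.+ 1
    initial = ℕ.+-cancelˡ-≡ (L ℕ.* Q ℕ.+ 1) _ _ (begin
      L ℕ.* Q ℕ.+ 1 ℕ.+ (2 ℕ.* Q ℕ.+ w)
        ≡⟨ solve 3 (λ L Q w → L :* Q :+ con 1 :+ (con 2 :* Q :+ w) := (con 2 :+ L) :* Q :+ w :+ con 1)
            ≡.refl L Q w ⟩
      (2 ℕ.+ L) ℕ.* Q ℕ.+ w ℕ.+ 1              ≡⟨ ≡.cong (λ x → x ℕ.+ w ℕ.+ 1) sum≡ ⟨
      sum (λ i → card (pullback (basis i) (whole n))) ℕ.+ w ℕ.+ 1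
        ≡⟨ hole-count (s≤s z≤n) (whole n) ⟩
      card (whole n) ℕ.+ (2 ℕ.+ L)             ≡⟨ ≡.cong (ℕ._+ (2 ℕ.+ L)) (card-whole n) ⟩
      q ℕ.^ n ℕ.+ (2 ℕ.+ L)
        ≡⟨ solve 2 (λ x L → x :+ (con 2 :+ L) := x :+ L :+ con 2) ≡.refl (q ℕ.^ n) L ⟩
      q ℕ.^ n ℕ.+ L ℕ.+ 2                      ≡⟨ ≡.cong (ℕ._+ 2) L≡ ⟨
      L ℕ.* Q ℕ.+ q ℕ.^ (t ℕ.+ r) ℕ.+ 2
        ≡⟨ ≡.cong (λ x → L ℕ.* Q ℕ.+ x ℕ.+ 2) (ℕ.^-distribˡ-+-* q t r) ⟩
      L ℕ.* Q ℕ.+ Q ℕ.* q ℕ.^ r ℕ.+ 2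
        ≡⟨ solve 3 (λ L Q x → L :* Q :+ Q :* x :+ con 2 := L :* Q :+ con 1 :+ (Q :* x :+ con 1))
            ≡.refl L Q (q ℕ.^ r) ⟩
      L ℕ.* Q ℕ.+ 1 ℕ.+ (Q ℕ.* q ℕ.^ r ℕ.+ 1)  ∎)
    q^r≡ : ∀ c → w ℕ.+ Q ≡ c ℕ.* p ℕ.* Q ℕ.+ 1 → q ℕ.^ r ≡ 1 ℕ.+ c ℕ.* p
    q^r≡ c eq = ℕ.*-cancelˡ-≡ _ _ Q {{ℕ.m^n≢0 q t}} (ℕ.+-cancelʳ-≡ 1 _ _ (begin
      Q ℕ.* q ℕ.^ r ℕ.+ 1                      ≡⟨ initial ⟨
      2 ℕ.* Q ℕ.+ w
        ≡⟨ solve 2 (λ Q w → con 2 :* Q :+ w := Q :+ (w :+ Q)) ≡.refl Q w ⟩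
      Q ℕ.+ (w ℕ.+ Q)                          ≡⟨ ≡.cong (Q ℕ.+_) eq ⟩
      Q ℕ.+ (c ℕ.* p ℕ.* Q ℕ.+ 1)
        ≡⟨ solve 2 (λ x Q → Q :+ (x :* Q :+ con 1) := Q :* (con 1 :+ x) :+ con 1) ≡.refl (c ℕ.* p) Q ⟩
      Q ℕ.* (1 ℕ.+ c ℕ.* p) ℕ.+ 1              ∎))
    conclude : (∃ λ c → w ℕ.+ Q ≡ c ℕ.* p ℕ.* Q ℕ.+ 1) → ∃ λ c → q ℕ.^ r ≡ 1 ℕ.+ c ℕ.* p × ¬ (c < t)
    conclude (c , eq) = c , q^r≡ c eq , descend t c (whole n) (whole-MeetsInPowers t≤n) Q∣L eq

-- Combination of the two bounds

restrict : ∀ {q} (F : FiniteField q) {n t m m′} → m′ ≤ m → PartialSpread F n t m → PartialSpread F n t m′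
restrict F m′≤m (S , disjoint) = (λ i → S (inject≤ i m′≤m)) , λ i j i≢j →
  disjoint _ _ λ eq → i≢j (Fin.inject≤-injective m′≤m m′≤m i j eq)

module Maximum {q : ℕ} (F : FiniteField q) (t r : ℕ) (0<t : 0 < t) where
  open SpreadConstruction F
  open FiniteFields F using (1<q)
  open HoleArithmetic using (power-∣)
  open import Data.Nat.Divisibility using (_∣_; ∣m∣n⇒∣m+n)
  open +-*-Solver

  private
    N : ℕ → ℕ
    N = dimension t r

  -- The number `L` of the upper bound, as the geometric sum that the construction produces. In this
  -- form divisibility by `q ^ t` is visible termwise, every exponent being at least `t`.
  excess : ℕ → ℕ
  excess zero    = 0
  excess (suc k) = q ℕ.^ N k ℕ.+ excess k

  size≡ : ∀ k → size t r k ≡ excess k ℕ.+ 1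
  size≡ zero    = ≡.refl
  size≡ (suc k) = ≡.trans (≡.cong (q ℕ.^ N k ℕ.+_) (size≡ k)) (≡.sym (ℕ.+-assoc (q ℕ.^ N k) (excess k) 1))

  excess-∣ : ∀ k → q ℕ.^ t ∣ excess k
  excess-∣ zero    = ℕ∣._∣0 (q ℕ.^ t)
  excess-∣ (suc k) = ∣m∣n⇒∣m+n (power-∣ q (t≤dimension t r k)) (excess-∣ k)

  excess-geometric : ∀ k → excess k ℕ.* q ℕ.^ t ℕ.+ q ℕ.^ (t ℕ.+ r) ≡ q ℕ.^ N k ℕ.+ excess k
  excess-geometric zero    = ≡.sym (ℕ.+-identityʳ _)
  excess-geometric (suc k) = begin
    (q ℕ.^ N k ℕ.+ excess k) ℕ.* Q ℕ.+ q ℕ.^ (t ℕ.+ r)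
      ≡⟨ solve 4 (λ x y Q z → (x :+ y) :* Q :+ z := Q :* x :+ (y :* Q :+ z))
          ≡.refl (q ℕ.^ N k) (excess k) Q (q ℕ.^ (t ℕ.+ r)) ⟩
    Q ℕ.* q ℕ.^ N k ℕ.+ (excess k ℕ.* Q ℕ.+ q ℕ.^ (t ℕ.+ r))
      ≡⟨ ≡.cong₂ ℕ._+_ (≡.sym (ℕ.^-distribˡ-+-* q t (N k))) (excess-geometric k) ⟩
    q ℕ.^ N (suc k) ℕ.+ excess (suc k) ∎
    where
    open ≡.≡-Reasoning
    Q = q ℕ.^ t

  -- Because `q ^ t` is at least 2, the divisor is `q ^ t - 1` in a visibly nonzero form;
  -- `excess-geometric` then makes the division exact.
  excess-quotient : ∀ k → (q ℕ.^ N k ℕ.∸ q ℕ.^ (t ℕ.+ r)) / suc (q ℕ.^ t ℕ.∸ 2) ≡ excess k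
  excess-quotient k = ≡.trans (/-congˡ (begin
      q ℕ.^ N k ℕ.∸ q ℕ.^ (t ℕ.+ r)
        ≡⟨ ≡.cong (ℕ._∸ q ℕ.^ (t ℕ.+ r)) q^N≡ ⟩
      excess k ℕ.* suc x ℕ.+ q ℕ.^ (t ℕ.+ r) ℕ.∸ q ℕ.^ (t ℕ.+ r) ≡⟨ ℕ.m+n∸n≡m _ (q ℕ.^ (t ℕ.+ r)) ⟩
      excess k ℕ.* suc x                                         ∎)) (m*n/n≡m (excess k) (suc x))
    where
    open ≡.≡-Reasoning
    x : ℕ
    x = q ℕ.^ t ℕ.∸ 2
    Q≡ : q ℕ.^ t ≡ 2 ℕ.+ x
    Q≡ = ≡.sym (ℕ.m+[n∸m]≡n (ℕ.^-monoʳ-< q 1<q 0<t))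
    q^N≡ : q ℕ.^ N k ≡ excess k ℕ.* suc x ℕ.+ q ℕ.^ (t ℕ.+ r)
    q^N≡ = ℕ.+-cancelʳ-≡ (excess k) _ _ (begin
      q ℕ.^ N k ℕ.+ excess k                          ≡⟨ excess-geometric k ⟨
      excess k ℕ.* q ℕ.^ t ℕ.+ q ℕ.^ (t ℕ.+ r)
        ≡⟨ ≡.cong (λ Q → excess k ℕ.* Q ℕ.+ q ℕ.^ (t ℕ.+ r)) Q≡ ⟩
      excess k ℕ.* (2 ℕ.+ x) ℕ.+ q ℕ.^ (t ℕ.+ r)
        ≡⟨ solve 3 (λ e x z → e :* (con 2 :+ x) :+ z := e :* (con 1 :+ x) :+ z :+ e)
            ≡.refl (excess k) x (q ℕ.^ (t ℕ.+ r)) ⟩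
      excess k ℕ.* suc x ℕ.+ q ℕ.^ (t ℕ.+ r) ℕ.+ excess k ∎)

  upperBound : (q ℕ.^ r ℕ.∸ 1) / suc (q ℕ.∸ 2) < t →
               ∀ k m → PartialSpread F (N k) t m → m ≤ excess k ℕ.+ 1
  upperBound θ<t k m spread with m ℕ.≤? excess k ℕ.+ 1
  ... | yes m≤ = m≤
  ... | no  m≰ = contradiction θ<t (refute (Descent.impossible F
        -- Surplus members are discarded so that exactly `2 + excess k` remain, the number for which
        -- `Descent` is set up.
        (restrict F (≡.subst (_≤ m) (≡.cong suc (ℕ.+-comm (excess k) 1)) (ℕ.≰⇒> m≰)) spread)
        r (t≤dimension t r k) (excess-∣ k) (excess-geometric k)))
    where
    open ≡.≡-Reasoning
    pred≡ : ∀ {q} → 1 < q → suc (q ℕ.∸ 2) ≡ ℕ.pred q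
    pred≡ {suc (suc q)} _ = ≡.refl
    pred≡ {suc zero} (s≤s ())
    quotient≡c : ∀ c → q ℕ.^ r ≡ 1 ℕ.+ c ℕ.* ℕ.pred q → (q ℕ.^ r ℕ.∸ 1) / suc (q ℕ.∸ 2) ≡ c
    quotient≡c c q^r≡ = begin
      (q ℕ.^ r ℕ.∸ 1) / suc (q ℕ.∸ 2)             ≡⟨ /-congˡ (≡.cong (ℕ._∸ 1) q^r≡) ⟩
      (c ℕ.* ℕ.pred q) / suc (q ℕ.∸ 2)            ≡⟨ /-congˡ (≡.cong (c ℕ.*_) (≡.sym (pred≡ 1<q))) ⟩
      (c ℕ.* suc (q ℕ.∸ 2)) / suc (q ℕ.∸ 2)       ≡⟨ m*n/n≡m c (suc (q ℕ.∸ 2)) ⟩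
      c                                           ∎
    refute : (∃ λ c → q ℕ.^ r ≡ 1 ℕ.+ c ℕ.* ℕ.pred q × ¬ (c < t)) → ¬ ((q ℕ.^ r ℕ.∸ 1) / suc (q ℕ.∸ 2) < t)
    refute (c , q^r≡ , c≮t) θ<t = c≮t (≡.subst (_< t) (quotient≡c c q^r≡) θ<t)

  maximum : (q ℕ.^ r ℕ.∸ 1) / suc (q ℕ.∸ 2) < t → ∀ k →
    IsMaxPartialSpreadSize F (N k) t ((q ℕ.^ N k ℕ.∸ q ℕ.^ (t ℕ.+ r)) / suc (q ℕ.^ t ℕ.∸ 2) ℕ.+ 1)
  maximum θ<t k = ≡.subst (λ L → IsMaxPartialSpreadSize F (N k) t (L ℕ.+ 1)) (≡.sym (excess-quotient k))
    (≡.subst (PartialSpread F (N k) t) (size≡ k) (partialSpread t r 0<t k) , upperBound θ<t k)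

  dimension≡ : ∀ k → N k ≡ r ℕ.+ suc k ℕ.* t
  dimension≡ zero    = solve 2 (λ t r → t :+ r := r :+ (t :+ con 0)) ≡.refl t r
  dimension≡ (suc k) = ≡.trans (≡.cong (t ℕ.+_) (dimension≡ k))
    (solve 3 (λ t r x → t :+ (r :+ x) := r :+ (t :+ x)) ≡.refl t r (suc k ℕ.* t))

open import Data.Nat using (_+_; _∸_; _^_)

theorem1p5 : (q : ℕ) (F : FiniteField q) (n t : ℕ) .{{_ : NonZero t}} →
    0 < n → t < n →
    (q ^ (n % t) ∸ 1) / suc (q ∸ 2) < t →
    IsMaxPartialSpreadSize F n t ((q ^ n ∸ q ^ (t + n % t)) / suc (q ^ t ∸ 2) + 1)
theorem1p5 q F n t _ t<n θ<t with n / t | m≡m%n+[m/n]*n n t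
-- With quotient zero, `n` equals its own remainder and would lie below `t`.
... | zero  | n≡ = contradiction (ℕ.<-trans t<n (≡.subst (_< t)
                     (≡.sym (≡.trans n≡ (ℕ.+-identityʳ (n % t)))) (m%n<n n t))) (ℕ.<-irrefl ≡.refl)
-- The construction starts in dimension `t + n % t`, which already uses one copy of `t`; a quotient
-- `suc k` therefore corresponds to `k` extensions.
... | suc k | n≡ = ≡.subst
    (λ N → IsMaxPartialSpreadSize F N t ((q ^ N ∸ q ^ (t + n % t)) / suc (q ^ t ∸ 2) + 1))
    (≡.trans (dimension≡ k) (≡.sym n≡)) (maximum θ<t k)
  where open Maximum F t (n % t) (ℕ.>-nonZero⁻¹ t)
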